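{- For a positive integer $n$, there exists an omniversal Latin square of order $n$ if and only if $n\notin\{3,4\}$ and $n\not\equiv 2 \pmod 4$.
   Context: A Latin square of order $n$ is an $n\times n$ array on $n$ symbols in which each row and each column contains each symbol exactly once; it is viewed as the set of triples $(r,c,s)$ where $s$ is the symbol in cell $(r,c)$. A partial transversal is a set of triples of the Latin square containing at most one triple in each row, at most one in each column, and at most one with each symbol; its length is its number of triples. It is maximal if it is not contained in a partial transversal of greater length. Every maximal partial transversal of a Latin square of order $n$ has length $\ell$ with $\lceil n/2\rceil\le \ell\le n$. A Latin square of order $n$ is omniversal if it has a maximal partial transversal of every length $\ell$ with $\lceil n/2\rceil\le \ell\le n$. -}

module Defs where

open import Data.Nat using (ℕ; _≤_; _<_; ⌈_/2⌉)
open import Data.Fin using (Fin)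
open import Data.Product using (_×_; Σ; ∃; proj₁; proj₂)
open import Data.List using (List; length)
open import Data.List.Membership.Propositional using (_∈_)
open import Data.List.Relation.Unary.AllPairs using (AllPairs)
open import Function.Definitions using (Injective)
open import Relation.Binary.PropositionalEquality using (_≡_)
open import Relation.Nullary using (¬_)

-- A Latin square of order n: a symbol L r c ∈ Fin n for each cell (r , c),
-- each row and each column containing each symbol exactly once.
-- (For maps Fin n → Fin n, containing each symbol exactly once is
-- equivalent to injectivity; we state it as injectivity of rows and columns.)
record LatinSquare (n : ℕ) : Set where
  field
    sym      : Fin n → Fin n → Fin n
    rowInj   : ∀ r → Injective _≡_ _≡_ (λ c → sym r c)
    colInj   : ∀ c → Injective _≡_ _≡_ (λ r → sym r c)

open LatinSquare public

-- A cell (r , c); the corresponding triple is (r , c , sym L r c).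
Cell : ℕ → Set
Cell n = Fin n × Fin n

Compatible : ∀ {n} → LatinSquare n → Cell n → Cell n → Set
Compatible L x y =
  ¬ (proj₁ x ≡ proj₁ y) × ¬ (proj₂ x ≡ proj₂ y) ×
  ¬ (sym L (proj₁ x) (proj₂ x) ≡ sym L (proj₁ y) (proj₂ y))

-- A partial transversal, represented as a list of triples (given by cells)
-- any two entries of which are in different rows, columns and symbols.
-- (In particular the list has no repetitions, so it is a set and its length
-- is the number of triples.)
IsPartialTransversal : ∀ {n} → LatinSquare n → List (Cell n) → Set
IsPartialTransversal L T = AllPairs (Compatible L) T

_⊆_ : ∀ {n} → List (Cell n) → List (Cell n) → Set
T ⊆ T' = ∀ {x} → x ∈ T → x ∈ T'

IsMaximalPartialTransversal : ∀ {n} → LatinSquare n → List (Cell n) → Set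
IsMaximalPartialTransversal L T =
  IsPartialTransversal L T ×
  ¬ (Σ (List (Cell _)) λ T' →
       IsPartialTransversal L T' × T ⊆ T' × length T < length T')

Omniversal : ∀ {n} → LatinSquare n → Set
Omniversal {n} L =
  ∀ ℓ → ⌈ n /2⌉ ≤ ℓ → ℓ ≤ n →
  Σ (List (Cell n)) λ T → IsMaximalPartialTransversal L T × length T ≡ ℓ

{-# OPTIONS --safe #-}
module Submission where

-- Necessity.  Let n = 2k and let T be a maximal partial transversal of length k.  The rows and columns that T
-- meets or misses cut the square into four subsquares of order k, so in every cell the number of row, column
-- and symbol that belong to T is odd.  Summing over a transversal gives 3k ≡ 2k (mod 2), hence k is even.  For
-- n = 4 the two cells of T itself contradict the splitting.
--
-- Sufficiency.  A partial transversal is maximal as soon as the rows and columns it misses only meet in symbols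
-- it uses.  The squares below consist of a core and h identical fibres, and the partial transversals of a piece
-- in the core and one gadget in each fibre, so that every length is obtained by exchanging gadgets one by one.
-- For odd n the square is [A B; C D] with a subsquare D of order (n-1)/2 which contains all missed cells.
-- For n = 4m it is the Klein four-group blown up by an idempotent Latin square of order m.  Its quotient
-- (u , i) ↦ u yields maximal partial transversals of length n - d for all even d ≤ n/2, and the quotient
-- (u , i) ↦ i would do the same; an intercalate switch that respects only the first quotient breaks the parity
-- condition of the second one, which then yields all odd d.

open import Defs
open import Algebra.Bundles using (module CommutativeRing)
open import Data.Bool using (Bool; true; false; not; _xor_; _∨_)
import Data.Bool.Properties as Bool
open import Algebra.Properties.CommutativeSemigroup (CommutativeRing.+-commutativeSemigroup Bool.xor-∧-commutativeRing) using () renaming (interchange to xor-interchange)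
open import Data.Empty using (⊥)
open import Data.Fin as Fin using (Fin; zero; suc; toℕ; fromℕ<; punchOut; splitAt; _↑ˡ_; _↑ʳ_; combine; remQuot; #_)
open import Data.Fin.Patterns
open import Data.Fin.Properties as Fin using (+↔⊎; *↔×)
open import Data.Integer as ℤ using (ℤ; _%ℕ_; _/ℕ_; +_; -[1+_]; ∣_∣; 1ℤ; 0ℤ; -1ℤ)
open import Data.Integer.DivMod using (n%ℕd<d; a≡a%ℕn+[a/ℕn]*n)
import Data.Integer.Properties as ℤ
open import Data.Integer.Tactic.RingSolver using () renaming (solve-∀ to solveℤ-∀)
open import Data.List using (List; []; _∷_; _++_; map; length; filter; allFin; concat; tabulate)
open import Data.List.Membership.Propositional using (_∈_; _∉_)
open import Data.List.Membership.Propositional.Properties using (∈-∃++; ∈-++⁺ˡ; ∈-++⁺ʳ; ∈-++⁻; ∈-map⁺; ∈-map⁻; ∈-allFin; ∈-filter⁺; ∈-filter⁻; ∈-concat⁺′; ∈-tabulate⁺)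
open import Data.List.Properties using (length-++; length-++-sucʳ; length-map; length-tabulate)
open import Data.List.Relation.Unary.All as All using (All; []; _∷_)
import Data.List.Relation.Unary.All.Properties as All
open import Data.List.Relation.Unary.AllPairs as AllPairs using (AllPairs; []; _∷_; allPairs?)
import Data.List.Relation.Unary.AllPairs.Properties as AllPairs
open import Data.List.Relation.Unary.Any using (here; there)
open import Data.List.Relation.Unary.Unique.Propositional using (Unique)
open import Data.List.Relation.Unary.Unique.Propositional.Properties as Unique using (Unique[x∷xs]⇒x∉xs)
open import Data.Maybe as Maybe using (Maybe; just; nothing)
open import Data.Maybe.Properties using (just-injective)
open import Data.Nat as ℕ using (ℕ; zero; suc; _≤_; _<_; z≤n; s≤s; s≤s⁻¹; ⌈_/2⌉; ⌊_/2⌋; _/_; _%_)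
open import Data.Nat.DivMod using (m≡m%n+[m/n]*n; m%n<n)
open import Data.Nat.ListAction using (sum)
import Data.Nat.Properties as ℕ
open import Data.Nat.Tactic.RingSolver using (solve-∀)
open import Data.Product using (Σ; ∃; _×_; _,_; proj₁; proj₂)
open import Data.Product.Properties using (,-injective; ,-injectiveʳ; ≡-dec)
open import Data.Sum using (_⊎_; inj₁; inj₂; [_,_]′)
open import Data.Sum.Function.Propositional using (_⊎-↔_)
open import Data.Sum.Properties as Sum using (inj₁-injective; inj₂-injective)
open import Data.Vec using (Vec; []; _∷_; lookup)
open import Function using (_∘_; id; _↔_; Inverse; mk↔ₛ′)
open import Function.Bundles using (_⇔_; mk⇔; module Equivalence)
open import Function.Properties.Inverse using (↔-refl; ↔-sym; ↔-trans)
open import Relation.Binary using (DecidableEquality)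
open import Relation.Binary.PropositionalEquality as ≡ using (_≡_; _≢_; refl; cong; cong₂; subst; subst₂; trans; module ≡-Reasoning)
open import Relation.Nullary using (¬_; Dec; yes; no; does; contradiction)
open import Relation.Nullary.Decidable using (¬?; _×-dec_; _⊎-dec_; _→-dec_; ⌊_⌋; from-yes)

-- Exchanging a gadget changes the length by two, so every odd step has to come from the core. The
-- core must therefore realise each excess from 0 up to a full transversal of itself; it is small
-- and handled cell by cell, while the fibres are uniform.
--
-- The parity condition for n = 4m is this. In a quotient of order two let T meet all rows and
-- columns of class 1 and all symbols of class 0, and let it miss d of each. Adding the classes of
-- row, column and symbol over T gives 0, but the count is 3n/2 - d, and n/2 is even; hence d is
-- even. An odd d thus needs a cell that violates the quotient. The switch exchanges two symbols
-- that agree in the first quotient and differ in the second. The price is that one missed cell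
-- receives a symbol of the wrong class, which T then has to contain as well.
--
-- Orders 1, 7 and 8 are too small for the general squares and are treated by evaluation. Order 3
-- needs its own argument, because the parity of cells says nothing about odd n.

private variable
  A B : Set

-- Maximality as a condition on single cells

Unique-⊆-length : {xs ys : List A} → Unique xs → (∀ {x} → x ∈ xs → x ∈ ys) → length xs ≤ length ys
Unique-⊆-length {xs = []} _ _ = z≤n
Unique-⊆-length {xs = x ∷ xs} u@(x≢ ∷ u′) sub with ∈-∃++ (sub (here refl))
... | as , bs , refl = subst (suc (length xs) ≤_) (≡.sym (length-++-sucʳ as x bs))
  (s≤s (Unique-⊆-length u′ λ {z} z∈ → rest z∈ (∈-++⁻ as (sub (there z∈)))))
  where
  rest : ∀ {z} → z ∈ xs → z ∈ as ⊎ z ∈ x ∷ bs → z ∈ as ++ bs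
  rest z∈ (inj₁ p) = ∈-++⁺ˡ p
  rest z∈ (inj₂ (there p)) = ∈-++⁺ʳ as p
  rest z∈ (inj₂ (here refl)) = contradiction z∈ (Unique[x∷xs]⇒x∉xs u)

module _ {n : ℕ} where
  open import Data.List.Membership.DecPropositional (Fin._≟_ {n}) using (_∈?_)

  Unique-⊇ : {xs ys : List (Fin n)} → Unique xs → (∀ {x} → x ∈ xs → x ∈ ys) →
    length ys ≤ length xs → ∀ {y} → y ∈ ys → y ∈ xs
  Unique-⊇ {xs} {ys} u sub len {y} y∈ with y ∈? xs
  ... | yes p = p
  ... | no y∉ = contradiction
    (ℕ.≤-trans (Unique-⊆-length (All.tabulate (λ z∈ y≡z → y∉ (subst (_∈ xs) (≡.sym y≡z) z∈)) ∷ u) sub′) len)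
    ℕ.1+n≰n
    where
    sub′ : ∀ {z} → z ∈ y ∷ xs → z ∈ ys
    sub′ (here refl) = y∈
    sub′ (there p) = sub p

  rowsOf colsOf : List (Cell n) → List (Fin n)
  rowsOf = map proj₁
  colsOf = map proj₂

  symbolAt : LatinSquare n → Cell n → Fin n
  symbolAt L x = sym L (proj₁ x) (proj₂ x)

  symsOf : LatinSquare n → List (Cell n) → List (Fin n)
  symsOf L = map (symbolAt L)

  -- Maximality quantifies over all larger lists; this condition is equivalent but can be checked
  -- cell by cell, hence decided by evaluation.
  Blocks : LatinSquare n → List (Cell n) → Set
  Blocks L T = ∀ r c → r ∈ rowsOf T ⊎ c ∈ colsOf T ⊎ sym L r c ∈ symsOf L T

  rows-Unique : ∀ {L T} → IsPartialTransversal L T → Unique (rowsOf T)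
  rows-Unique = AllPairs.map⁺ ∘ AllPairs.map proj₁

  cols-Unique : ∀ {L T} → IsPartialTransversal L T → Unique (colsOf T)
  cols-Unique = AllPairs.map⁺ ∘ AllPairs.map (proj₁ ∘ proj₂)

  syms-Unique : ∀ {L T} → IsPartialTransversal L T → Unique (symsOf L T)
  syms-Unique = AllPairs.map⁺ ∘ AllPairs.map (proj₂ ∘ proj₂)

  maximal⇒blocks : ∀ {L T} → IsMaximalPartialTransversal L T → Blocks L T
  maximal⇒blocks {L} {T} (pt , max) r c with r ∈? rowsOf T | c ∈? colsOf T | sym L r c ∈? symsOf L T
  ... | yes p | _ | _ = inj₁ p
  ... | no _ | yes p | _ = inj₂ (inj₁ p)
  ... | no _ | no _ | yes p = inj₂ (inj₂ p)
  ... | no r∉ | no c∉ | no s∉ = contradiction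
    ((r , c) ∷ T , All.tabulate (λ x∈ → (λ e → r∉ (subst (_∈ rowsOf T) (≡.sym e) (∈-map⁺ proj₁ x∈)))
                                      , (λ e → c∉ (subst (_∈ colsOf T) (≡.sym e) (∈-map⁺ proj₂ x∈)))
                                      , (λ e → s∉ (subst (_∈ symsOf L T) (≡.sym e) (∈-map⁺ (symbolAt L) x∈)))) ∷ pt
    , (λ {x} → there) , ℕ.≤-refl) max

  private
    related : ∀ {R : A → A → Set} {xs x y} → AllPairs R xs → x ∈ xs → y ∈ xs → x ≡ y ⊎ R x y ⊎ R y x
    related (_ ∷ _) (here refl) (here refl) = inj₁ refl
    related (p ∷ _) (here refl) (there y∈) = inj₂ (inj₁ (All.lookup p y∈))
    related (p ∷ _) (there x∈) (here refl) = inj₂ (inj₂ (All.lookup p x∈))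
    related (_ ∷ ps) (there x∈) (there y∈) = related ps x∈ y∈

  -- Each cell of a larger T′ shares its row, column or symbol with a cell of T, which also lies in
  -- T′. Two cells of T′ that share one of these coincide, so T′ is contained in T and is not
  -- longer.
  blocks⇒maximal : ∀ {L T} → IsPartialTransversal L T → Blocks L T → IsMaximalPartialTransversal L T
  blocks⇒maximal {L} {T} pt blk = pt , λ (T′ , pt′ , T⊆T′ , lt) →
    contradiction lt (ℕ.≤⇒≯ (Unique-⊆-length (AllPairs.map (λ (r≢ , _) e → r≢ (cong proj₁ e)) pt′) (inside T′ pt′ T⊆T′)))
    where
    module _ T′ (pt′ : IsPartialTransversal L T′) (T⊆T′ : T ⊆ T′) where
      clash : ∀ {x} → x ∈ T′ → (f : Cell n → Fin n) → (∀ {y z} → Compatible L y z → f y ≢ f z) →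
        f x ∈ map f T → x ∈ T
      clash x∈ f sep fx∈ with ∈-map⁻ f fx∈
      ... | y , y∈ , e with related pt′ x∈ (T⊆T′ y∈)
      ... | inj₁ refl = y∈
      ... | inj₂ (inj₁ R) = contradiction e (sep R)
      ... | inj₂ (inj₂ R) = contradiction (≡.sym e) (sep R)

      inside : ∀ {x} → x ∈ T′ → x ∈ T
      inside {r , c} x∈ with blk r c
      ... | inj₁ p = clash x∈ proj₁ proj₁ p
      ... | inj₂ (inj₁ p) = clash x∈ proj₂ (proj₁ ∘ proj₂) p
      ... | inj₂ (inj₂ p) = clash x∈ (symbolAt L) (proj₂ ∘ proj₂) p

  -- Necessity: the splitting for length n/2

  complement : List (Fin n) → List (Fin n)
  complement xs = filter (λ x → ¬? (x ∈? xs)) (allFin n)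

  complement-Unique : ∀ xs → Unique (complement xs)
  complement-Unique xs = Unique.filter⁺ (λ x → ¬? (x ∈? xs)) (Unique.allFin⁺ n)

  ∈-complement⁺ : ∀ {xs x} → x ∉ xs → x ∈ complement xs
  ∈-complement⁺ {xs} = ∈-filter⁺ (λ x → ¬? (x ∈? xs)) (∈-allFin _)

  ∈-complement⁻ : ∀ {xs x} → x ∈ complement xs → x ∉ xs
  ∈-complement⁻ {xs} x∈ = proj₂ (∈-filter⁻ (λ x → ¬? (x ∈? xs)) {xs = allFin n} x∈)

  length-complement : ∀ {xs} → Unique xs → length (complement xs) ℕ.+ length xs ≡ n
  length-complement {xs} u = trans (≡.sym (length-++ (complement xs) {xs})) (ℕ.≤-antisym
    (subst (length (complement xs ++ xs) ≤_) (length-tabulate id) (Unique-⊆-length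
      (AllPairs.++⁺ (complement-Unique xs) u
        (All.tabulate λ x∈ → All.tabulate λ y∈ e → ∈-complement⁻ x∈ (subst (_∈ xs) (≡.sym e) y∈)))
      (λ _ → ∈-allFin _)))
    (subst (_≤ length (complement xs ++ xs)) (length-tabulate id) (Unique-⊆-length (Unique.allFin⁺ n) λ {x} _ → cover x)))
    where
    cover : ∀ x → x ∈ complement xs ++ xs
    cover x with x ∈? xs
    ... | yes p = ∈-++⁺ʳ (complement xs) p
    ... | no ¬p = ∈-++⁺ˡ (∈-complement⁺ ¬p)

  -- The square splits into four subsquares of order k: in the rows T misses, the columns T misses already
  -- take up all k symbols of T.
  module Halves {L : LatinSquare n} {T : List (Cell n)} {k : ℕ}
    (n≡ : n ≡ k ℕ.+ k) (max : IsMaximalPartialTransversal L T) (len : length T ≡ k) where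

    private
      pt = proj₁ max

      half : ∀ {xs} → Unique xs → length xs ≡ k → length (complement xs) ≡ k
      half {xs} u l = ℕ.+-cancelʳ-≡ k _ _ (trans (cong (length (complement xs) ℕ.+_) (≡.sym l)) (trans (length-complement u) n≡))

      rows-complement : length (complement (rowsOf T)) ≡ k
      rows-complement = half (rows-Unique {L} pt) (trans (length-map proj₁ T) len)

      cols-complement : length (complement (colsOf T)) ≡ k
      cols-complement = half (cols-Unique {L} pt) (trans (length-map proj₂ T) len)

      syms-complement : length (complement (symsOf L T)) ≡ k
      syms-complement = half (syms-Unique {L} pt) (trans (length-map (symbolAt L) T) len)

      -- Both lists have length k, so the images of `xs` already use up `ys`, and by injectivity no
      -- other element can be mapped there. Applied to a row or a column of the square, this turns
      -- the content of one quarter into that of its neighbour.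
      onto : (f : Fin n → Fin n) → (∀ {x y} → f x ≡ f y → x ≡ y) → ∀ {xs ys} → Unique xs → length xs ≡ k → length ys ≡ k →
        (∀ {x} → x ∈ xs → f x ∈ ys) → ∀ {x} → f x ∈ ys → x ∈ xs
      onto f inj {xs} {ys} u lx ly maps {x} fx∈ with ∈-map⁻ f
        (Unique-⊇ {map f xs} (Unique.map⁺ inj u) into (ℕ.≤-reflexive (trans ly (≡.sym (trans (length-map f xs) lx)))) fx∈)
        where
        into : ∀ {y} → y ∈ map f xs → y ∈ ys
        into y∈ with ∈-map⁻ f y∈
        ... | z , z∈ , refl = maps z∈
      ... | z , z∈ , e = subst (_∈ xs) (≡.sym (inj e)) z∈

    out-out : ∀ {r c} → r ∉ rowsOf T → c ∉ colsOf T → sym L r c ∈ symsOf L T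
    out-out {r} {c} r∉ c∉ with maximal⇒blocks {L} max r c
    ... | inj₁ p = contradiction p r∉
    ... | inj₂ (inj₁ p) = contradiction p c∉
    ... | inj₂ (inj₂ p) = p

    out-in : ∀ {r c} → r ∉ rowsOf T → c ∈ colsOf T → sym L r c ∉ symsOf L T
    out-in {r} r∉ c∈ s∈ = ∈-complement⁻ (onto (sym L r) (rowInj L r) (complement-Unique (colsOf T)) cols-complement
      (trans (length-map (symbolAt L) T) len) (λ c∈ → out-out r∉ (∈-complement⁻ c∈)) s∈) c∈

    in-out : ∀ {r c} → r ∈ rowsOf T → c ∉ colsOf T → sym L r c ∉ symsOf L T
    in-out {r} {c} r∈ c∉ s∈ = ∈-complement⁻ (onto (λ r → sym L r c) (colInj L c) (complement-Unique (rowsOf T)) rows-complement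
      (trans (length-map (symbolAt L) T) len) (λ r∈ → out-out (∈-complement⁻ r∈) c∉) s∈) r∈

    in-in : ∀ {r c} → r ∈ rowsOf T → c ∈ colsOf T → sym L r c ∈ symsOf L T
    in-in {r} {c} r∈ c∈ with sym L r c ∈? symsOf L T
    ... | yes p = p
    ... | no s∉ = contradiction c∈ (∈-complement⁻ (onto (sym L r) (rowInj L r) (complement-Unique (colsOf T)) cols-complement
      syms-complement (λ c∈ → ∈-complement⁺ (in-out r∈ (∈-complement⁻ c∈))) (∈-complement⁺ s∉)))

  member : List (Fin n) → Fin n → Bool
  member xs x = does (x ∈? xs)

  -- In the four quarters the number of memberships is 3, 1, 1 and 1.
  member-sum : ∀ {L T k} → n ≡ k ℕ.+ k → IsMaximalPartialTransversal L T → length T ≡ k → ∀ r c →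
    (member (rowsOf T) r xor member (colsOf T) c) xor member (symsOf L T) (sym L r c) ≡ true
  member-sum {L} {T} n≡ max len r c with r ∈? rowsOf T | c ∈? colsOf T | sym L r c ∈? symsOf L T
  ... | yes _ | yes _ | yes _ = refl
  ... | yes r∈ | yes c∈ | no s∉ = contradiction (Halves.in-in {L = L} n≡ max len r∈ c∈) s∉
  ... | yes r∈ | no c∉ | yes s∈ = contradiction s∈ (Halves.in-out {L = L} n≡ max len r∈ c∉)
  ... | yes _ | no _ | no _ = refl
  ... | no r∉ | yes c∈ | yes s∈ = contradiction s∈ (Halves.out-in {L = L} n≡ max len r∉ c∈)
  ... | no _ | yes _ | no _ = refl
  ... | no _ | no _ | yes _ = refl
  ... | no r∉ | no c∉ | no s∉ = contradiction (Halves.out-out {L = L} n≡ max len r∉ c∉) s∉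

-- Necessity: the parity argument

parity : ℕ → Bool
parity zero = false
parity (suc n) = not (parity n)

parity-+ : ∀ m n → parity (m ℕ.+ n) ≡ parity m xor parity n
parity-+ zero n = refl
parity-+ (suc m) n = trans (cong not (parity-+ m n)) (Bool.not-distribˡ-xor (parity m) (parity n))

parity-double : ∀ k → parity (k ℕ.+ k) ≡ false
parity-double k = trans (parity-+ k k) (Bool.xor-same (parity k))

xorSum : (A → Bool) → List A → Bool
xorSum f [] = false
xorSum f (x ∷ xs) = f x xor xorSum f xs

xorSum-xor : (f g : A → Bool) (xs : List A) → xorSum (λ x → f x xor g x) xs ≡ xorSum f xs xor xorSum g xs
xorSum-xor f g [] = refl
xorSum-xor f g (x ∷ xs) = trans (cong ((f x xor g x) xor_) (xorSum-xor f g xs))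
  (xor-interchange (f x) (g x) (xorSum f xs) (xorSum g xs))

xorSum-true : {f : A → Bool} → (∀ x → f x ≡ true) → ∀ xs → xorSum f xs ≡ parity (length xs)
xorSum-true e [] = refl
xorSum-true e (x ∷ xs) rewrite e x = cong not (xorSum-true e xs)

xorSum-map : (f : B → Bool) (g : A → B) (xs : List A) → xorSum (f ∘ g) xs ≡ xorSum f (map g xs)
xorSum-map f g [] = refl
xorSum-map f g (x ∷ xs) = cong (f (g x) xor_) (xorSum-map f g xs)

module _ {n : ℕ} where
  open import Data.List.Membership.DecPropositional (Fin._≟_ {n}) using (_∈?_)

  xorSum-member : ∀ xs ys → xorSum (member xs) ys ≡ parity (length (filter (_∈? xs) ys))
  xorSum-member xs [] = refl
  xorSum-member xs (y ∷ ys) with does (y ∈? xs)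
  ... | true = cong not (xorSum-member xs ys)
  ... | false = xorSum-member xs ys

  -- A list of n distinct elements of `Fin n` runs through all of them, so it meets each member of
  -- `xs` exactly once.
  xorSum-member-full : ∀ {xs ys} → Unique xs → Unique ys → length ys ≡ n → xorSum (member xs) ys ≡ parity (length xs)
  xorSum-member-full {xs} {ys} ux uy ly = trans (xorSum-member xs ys) (cong parity (ℕ.≤-antisym
    (Unique-⊆-length (Unique.filter⁺ (_∈? xs) uy) (λ z∈ → proj₂ (∈-filter⁻ (_∈? xs) {xs = ys} z∈)))
    (Unique-⊆-length ux (λ z∈ → ∈-filter⁺ (_∈? xs) (full _) z∈))))
    where
    full : ∀ z → z ∈ ys
    full z = Unique-⊇ uy (λ _ → ∈-allFin _) (ℕ.≤-reflexive (trans (length-tabulate id) (≡.sym ly))) (∈-allFin z)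

  no-transversal : ∀ {L : LatinSquare n} {T T₀ k} → n ≡ k ℕ.+ k → parity k ≡ true → IsMaximalPartialTransversal L T → length T ≡ k →
    IsPartialTransversal L T₀ → length T₀ ≡ n → ⊥
  no-transversal {L} {T} {T₀} {k} n≡ odd max len pt₀ len₀ = contradiction
    (trans (≡.sym (trans lhs (cong parity (trans len₀ n≡)))) rhs) λ e → contradiction (trans (≡.sym (parity-double k)) e) λ ()
    where
    ρ γ σ : Cell n → Bool
    ρ = member (rowsOf T) ∘ proj₁
    γ = member (colsOf T) ∘ proj₂
    σ = member (symsOf L T) ∘ symbolAt L

    lhs : xorSum (λ x → (ρ x xor γ x) xor σ x) T₀ ≡ parity (length T₀)
    lhs = xorSum-true (λ x → member-sum {L = L} n≡ max len (proj₁ x) (proj₂ x)) T₀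

    part : (f : Cell n → Fin n) → Unique (map f T) → Unique (map f T₀) → xorSum (member (map f T) ∘ f) T₀ ≡ true
    part f u u₀ = trans (xorSum-map _ f T₀) (trans (xorSum-member-full u u₀ (trans (length-map f T₀) len₀))
      (trans (cong parity (trans (length-map f T) len)) odd))

    rhs : xorSum (λ x → (ρ x xor γ x) xor σ x) T₀ ≡ true
    rhs = begin
      xorSum (λ x → (ρ x xor γ x) xor σ x) T₀ ≡⟨ xorSum-xor _ σ T₀ ⟩
      xorSum (λ x → ρ x xor γ x) T₀ xor xorSum σ T₀ ≡⟨ cong (_xor xorSum σ T₀) (xorSum-xor ρ γ T₀) ⟩
      (xorSum ρ T₀ xor xorSum γ T₀) xor xorSum σ T₀ ≡⟨ cong₂ _xor_ (cong₂ _xor_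
        (part proj₁ (rows-Unique {L = L} (proj₁ max)) (rows-Unique {L = L} pt₀))
        (part proj₂ (cols-Unique {L = L} (proj₁ max)) (cols-Unique {L = L} pt₀)))
        (part (symbolAt L) (syms-Unique {L = L} (proj₁ max)) (syms-Unique {L = L} pt₀)) ⟩
      true ∎
      where open ≡-Reasoning

¬omniversal-2mod4 : ∀ {n} (L : LatinSquare n) → n % 4 ≡ 2 → ¬ Omniversal L
¬omniversal-2mod4 {n} L n%4 omni
  with omni ⌈ n /2⌉ ℕ.≤-refl (ℕ.⌈n/2⌉≤n n) | omni n (ℕ.⌈n/2⌉≤n n) ℕ.≤-refl
... | T , max , len | T₀ , (pt₀ , _) , len₀ = no-transversal {L = L} n≡ odd max (trans len (trans (cong ⌈_/2⌉ n≡) (≡.sym (ℕ.n≡⌈n+n/2⌉ k)))) pt₀ len₀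
  where
  q = n ℕ./ 4
  k = suc (q ℕ.+ q)
  n≡ : n ≡ k ℕ.+ k
  n≡ = trans (m≡m%n+[m/n]*n n 4) (trans (cong (ℕ._+ q ℕ.* 4) n%4) (lem q))
    where
    lem : ∀ q → 2 ℕ.+ q ℕ.* 4 ≡ suc (q ℕ.+ q) ℕ.+ suc (q ℕ.+ q)
    lem = solve-∀
  odd : parity k ≡ true
  odd = cong not (parity-double q)

-- Necessity: orders 4 and 3

¬omniversal-4 : (L : LatinSquare 4) → ¬ Omniversal L
¬omniversal-4 L omni with omni 2 ℕ.≤-refl (s≤s (s≤s z≤n))
... | (r₁ , c₁) ∷ (r₂ , c₂) ∷ [] , max@((((r≢ , c≢ , _) ∷ []) ∷ _) , _) , refl
  -- The cell in row r₁ and column c₂ would have to carry one of the two symbols of T, but the first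
  -- already stands in row r₁ and the second in column c₂.
  with Halves.in-in {L = L} {k = 2} refl max refl {r₁} {c₂} (here refl) (there (here refl))
... | here e = c≢ (≡.sym (rowInj L r₁ e))
... | there (here e) = r≢ (colInj L c₂ e)

-- A maximal T of length 2 misses one row r and one column c, and the symbol at (r , c) belongs to
-- T, say to (r₁ , c₁). In row r₂ that symbol is then excluded from c₁ and c by the columns, and
-- from c₂ because T has another symbol there.
¬omniversal-3 : (L : LatinSquare 3) → ¬ Omniversal L
¬omniversal-3 L omni with omni 2 ℕ.≤-refl (s≤s (s≤s z≤n))
... | T@((r₁ , c₁) ∷ (r₂ , c₂) ∷ []) , max@((((r≢ , c≢ , s≢) ∷ []) ∷ _) , _) , refl
  with complement (rowsOf T) in eqr | length-complement (rows-Unique {L = L} (proj₁ max))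
     | complement (colsOf T) in eqc | length-complement (cols-Unique {L = L} (proj₁ max))
... | r ∷ _ | _ | c ∷ _ | _ = bad (maximal⇒blocks {L = L} max r c)
  where
  r∉ : r ∉ rowsOf T
  r∉ = ∈-complement⁻ (subst (r ∈_) (≡.sym eqr) (here refl))
  c∉ : c ∉ colsOf T
  c∉ = ∈-complement⁻ (subst (c ∈_) (≡.sym eqc) (here refl))

  -- The three columns are distinct, so a row that lacks `s` in all of them would give four distinct
  -- elements of `Fin 3`.
  missing : ∀ r′ s → s ∉ map (sym L r′) (c₁ ∷ c₂ ∷ c ∷ []) → ⊥
  missing r′ s s∉ = contradiction
    (Unique-⊆-length (All.tabulate (λ z∈ e → s∉ (subst (_∈ _) (≡.sym e) z∈))
      ∷ Unique.map⁺ (rowInj L r′) ((c≢ ∷ (λ e → c∉ (here (≡.sym e))) ∷ []) ∷ ((λ e → c∉ (there (here (≡.sym e)))) ∷ []) ∷ [] ∷ []))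
      (λ _ → ∈-allFin _)) ℕ.1+n≰n

  bad : r ∈ rowsOf T ⊎ c ∈ colsOf T ⊎ sym L r c ∈ symsOf L T → ⊥
  bad (inj₁ p) = r∉ p
  bad (inj₂ (inj₁ p)) = c∉ p
  bad (inj₂ (inj₂ (here e))) = missing r₂ (sym L r₁ c₁) λ where
    (here e′) → r≢ (colInj L c₁ e′)
    (there (here e′)) → s≢ e′
    (there (there (here e′))) → r∉ (there (here (colInj L c (trans e e′))))
  bad (inj₂ (inj₂ (there (here e)))) = missing r₁ (sym L r₂ c₂) λ where
    (here e′) → s≢ (≡.sym e′)
    (there (here e′)) → r≢ (≡.sym (colInj L c₂ e′))
    (there (there (here e′))) → r∉ (here (colInj L c (trans e e′)))

-- Latin squares on structured index sets

-- Rows, columns and symbols may be arbitrary sets, so that points can carry their structure (core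
-- or fibre, block, extra point); `Transport` numbers them only at the end.
record Latin (R C S : Set) : Set where
  field
    at : R → C → S
    row-injective : ∀ r {c c′} → at r c ≡ at r c′ → c ≡ c′
    col-injective : ∀ c {r r′} → at r c ≡ at r′ c → r ≡ r′

open Latin public

Triple : Set → Set
Triple A = A × A × A

row col symbol : {A : Set} → Triple A → A
row = proj₁
col = proj₁ ∘ proj₂
symbol = proj₂ ∘ proj₂

mapTriple : {A B : Set} → (A → B) → Triple A → Triple B
mapTriple f (r , c , s) = f r , f c , f s

Apart : {A : Set} → Triple A → Triple A → Set
Apart t t′ = row t ≢ row t′ × col t ≢ col t′ × symbol t ≢ symbol t′

-- Rows, columns and symbols that a partial transversal is required to meet.
record Region (A : Set) : Set where
  constructor region
  field
    rows cols syms : A → Bool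

open Region public

Covers : {A : Set} → Region A → List (Triple A) → Set
Covers P T = (∀ a → rows P a ≡ true → a ∈ map row T)
           × (∀ a → cols P a ≡ true → a ∈ map col T)
           × (∀ a → syms P a ≡ true → a ∈ map symbol T)

Good : {A : Set} → Region A → List (Triple A) → Set
Good P T = AllPairs Apart T × Covers P T

good? : ∀ {k} (P : Region (Fin k)) (T : List (Triple (Fin k))) → Dec (Good P T)
good? {k} P T = allPairs? (λ t t′ → ¬? (row t Fin.≟ row t′) ×-dec ¬? (col t Fin.≟ col t′) ×-dec ¬? (symbol t Fin.≟ symbol t′)) T
  ×-dec covers? rows row ×-dec covers? cols col ×-dec covers? syms symbol
  where
  open import Data.List.Membership.DecPropositional (Fin._≟_ {k}) using (_∈?_)
  covers? : (f : Region (Fin k) → Fin k → Bool) (g : Triple (Fin k) → Fin k) → Dec (∀ a → f P a ≡ true → a ∈ map g T)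
  covers? f g = Fin.all? λ a → (f P a Bool.≟ true) →-dec (a ∈? map g T)

-- A proof by `refl` of the Boolean equation only forces the decision itself to be evaluated, not
-- the evidence it carries.
witness : {A : Set} (a? : Dec A) → does a? ≡ true → A
witness (yes a) _ = a

good! : ∀ {k} (P : Region (Fin k)) (T : List (Triple (Fin k))) → does (good? P T) ≡ true → Good P T
good! P T = witness (good? P T)

Valid : {R C S : Set} → Latin R C S → R × C × S → Set
Valid L (r , c , s) = at L r c ≡ s

-- This involves the square and the region but no partial transversal, so one proof serves all lists
-- that cover the region.
Blocked : {A : Set} → Latin A A A → Region A → Set
Blocked L P = ∀ x y → rows P x ≡ false → cols P y ≡ false → syms P (at L x y) ≡ true

module Transport {A : Set} {n : ℕ} (A↔Fin : A ↔ Fin n) (L : Latin A A A) where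
  open Inverse A↔Fin using (to; from; strictlyInverseˡ; strictlyInverseʳ)

  private
    to-injective : ∀ {x y} → to x ≡ to y → x ≡ y
    to-injective e = trans (≡.sym (strictlyInverseʳ _)) (trans (cong from e) (strictlyInverseʳ _))

    from-injective : ∀ {x y} → from x ≡ from y → x ≡ y
    from-injective e = trans (≡.sym (strictlyInverseˡ _)) (trans (cong to e) (strictlyInverseˡ _))

  square : LatinSquare n
  square = record
    { sym = λ r c → to (at L (from r) (from c))
    ; rowInj = λ r → from-injective ∘ row-injective L (from r) ∘ to-injective
    ; colInj = λ c → from-injective ∘ col-injective L (from c) ∘ to-injective
    }

  cell : Triple A → Cell n
  cell (r , c , _) = to r , to c

  cell-symbol : ∀ {t} → Valid L t → symbolAt square (cell t) ≡ to (symbol t)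
  cell-symbol {r , c , s} v rewrite strictlyInverseʳ r | strictlyInverseʳ c = cong to v

  maximal : ∀ {T P} → All (Valid L) T → Good P T → Blocked L P →
    IsMaximalPartialTransversal square (map cell T)
  maximal {T} {P} valid (apart , coverʳ , coverᶜ , coverˢ) blocked = blocks⇒maximal {L = square}
    (AllPairs.map⁺ (compatible valid apart)) blk
    where
    compatible : ∀ {T} → All (Valid L) T → AllPairs Apart T → AllPairs (λ t t′ → Compatible square (cell t) (cell t′)) T
    compatible [] [] = []
    compatible (v ∷ vs) (a ∷ as) = All.zipWith (λ (w , r , c , s) → r ∘ to-injective , c ∘ to-injective
      , λ e → s (to-injective (trans (≡.sym (cell-symbol v)) (trans e (cell-symbol w))))) (vs , a) ∷ compatible vs as

    image : ∀ {x} {f : Triple A → A} {g : Cell n → Fin n} → (∀ {t} → Valid L t → g (cell t) ≡ to (f t)) →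
      from x ∈ map f T → x ∈ map g (map cell T)
    image {x} {f} {g} comm x∈ with ∈-map⁻ f x∈
    ... | t , t∈ , e = subst (_∈ map g (map cell T))
      (trans (comm (All.lookup valid t∈)) (trans (cong to (≡.sym e)) (strictlyInverseˡ x)))
      (∈-map⁺ g (∈-map⁺ cell t∈))

    blk : Blocks square (map cell T)
    blk r c with rows P (from r) in eqr | cols P (from c) in eqc
    ... | true | _ = inj₁ (image {f = row} (λ _ → refl) (coverʳ _ eqr))
    ... | false | true = inj₂ (inj₁ (image {f = col} (λ _ → refl) (coverᶜ _ eqc)))
    ... | false | false = inj₂ (inj₂ (image {f = symbol} cell-symbol
      (subst (_∈ map symbol T) (≡.sym (strictlyInverseʳ _)) (coverˢ _ (blocked _ _ eqr eqc)))))

-- Assembling a core and gadgets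

-- A core of nc points together with h fibres of ng points each.
Blown : ℕ → ℕ → ℕ → Set
Blown nc ng h = Fin nc ⊎ (Fin h × Fin ng)

Blown↔Fin : ∀ nc ng h → Blown nc ng h ↔ Fin (nc ℕ.+ h ℕ.* ng)
Blown↔Fin nc ng h = ↔-trans (↔-refl ⊎-↔ ↔-sym *↔×) (↔-sym +↔⊎)

module Assemble {nc ng h : ℕ} where
  private V = Blown nc ng h

  gen : Fin h → Fin ng → V
  gen q a = inj₂ (q , a)

  assemble : List (Triple (Fin nc)) → (Fin h → List (Triple (Fin ng))) → List (Triple V)
  assemble κ g = map (mapTriple inj₁) κ ++ concat (tabulate λ q → map (mapTriple (gen q)) (g q))

  join : Region (Fin nc) → Region (Fin ng) → Region V
  join P Q = region [ rows P , rows Q ∘ proj₂ ]′ [ cols P , cols Q ∘ proj₂ ]′ [ syms P , syms Q ∘ proj₂ ]′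

  private
    Apart-map : ∀ {A B : Set} {f : A → B} → (∀ {x y} → f x ≡ f y → x ≡ y) → ∀ {t t′} → Apart t t′ → Apart (mapTriple f t) (mapTriple f t′)
    Apart-map inj (r , c , s) = r ∘ inj , c ∘ inj , s ∘ inj

    separate : ∀ {A B : Set} {f : A → V} {f′ : B → V} {xs ys} → (∀ x y → f x ≢ f′ y) →
      All (λ t → All (Apart t) (map (mapTriple f′) ys)) (map (mapTriple f) xs)
    separate ne = All.map⁺ (All.tabulate λ _ → All.map⁺ (All.tabulate λ _ → ne _ _ , ne _ _ , ne _ _))

  assemble-valid : ∀ {L : Latin V V V} {κ g} → All (Valid L ∘ mapTriple inj₁) κ → (∀ q → All (Valid L ∘ mapTriple (gen q)) (g q)) →
    All (Valid L) (assemble κ g)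
  assemble-valid vκ vg = All.++⁺ (All.map⁺ vκ) (All.concat⁺ (All.tabulate⁺ λ q → All.map⁺ (vg q)))

  assemble-good : ∀ {P Q κ g} → Good P κ → (∀ q → Good Q (g q)) → Good (join P Q) (assemble κ g)
  assemble-good {P} {Q} {κ} {g} (aκ , rκ , cκ , sκ) G =
    AllPairs.++⁺ (AllPairs.map⁺ (AllPairs.map (Apart-map inj₁-injective) aκ))
      (AllPairs.concat⁺
        (All.tabulate⁺ λ q → AllPairs.map⁺ (AllPairs.map (Apart-map (,-injectiveʳ ∘ inj₂-injective)) (proj₁ (G q))))
        (AllPairs.tabulate⁺ λ i≢j → separate {f = gen _} λ _ _ e → i≢j (proj₁ (,-injective (inj₂-injective e)))))
      (All.map⁺ (All.tabulate λ _ → All.concat⁺ (All.tabulate⁺ {f = λ q → map (mapTriple (gen q)) (g q)}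
        λ q → All.map⁺ (All.tabulate λ _ → (λ ()) , (λ ()) , λ ()))))
    , (λ { (inj₁ a) e → core row (λ _ → refl) (rκ a e) ; (inj₂ (q , a)) e → generic row (λ _ → refl) (proj₁ (proj₂ (G q)) a e) })
    , (λ { (inj₁ a) e → core col (λ _ → refl) (cκ a e) ; (inj₂ (q , a)) e → generic col (λ _ → refl) (proj₁ (proj₂ (proj₂ (G q))) a e) })
    , (λ { (inj₁ a) e → core symbol (λ _ → refl) (sκ a e) ; (inj₂ (q , a)) e → generic symbol (λ _ → refl) (proj₂ (proj₂ (proj₂ (G q))) a e) })
    where
    core : (f : ∀ {A} → Triple A → A) → (∀ (t : Triple (Fin nc)) → f (mapTriple inj₁ t) ≡ inj₁ (f t)) → ∀ {a} → a ∈ map f κ →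
      inj₁ a ∈ map f (assemble κ g)
    core f nat a∈ with ∈-map⁻ f a∈
    ... | t , t∈ , refl = subst (_∈ map f (assemble κ g)) (nat t) (∈-map⁺ f (∈-++⁺ˡ (∈-map⁺ (mapTriple inj₁) t∈)))

    generic : (f : ∀ {A} → Triple A → A) → (∀ {q} (t : Triple (Fin ng)) → f (mapTriple (gen q) t) ≡ gen q (f t)) → ∀ {q a} → a ∈ map f (g q) →
      gen q a ∈ map f (assemble κ g)
    generic f nat {q} a∈ with ∈-map⁻ f a∈
    ... | t , t∈ , refl = subst (_∈ map f (assemble κ g)) (nat t) (∈-map⁺ f (∈-++⁺ʳ (map (mapTriple inj₁) κ)
      (∈-concat⁺′ (∈-map⁺ (mapTriple (gen q)) t∈) (∈-tabulate⁺ {f = λ q → map (mapTriple (gen q)) (g q)} q))))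

length-concat-tabulate : ∀ {A : Set} {h b} (f : Fin h → List A) (w : Fin h → ℕ) → (∀ q → length (f q) ≡ b ℕ.+ 2 ℕ.* w q) →
  length (concat (tabulate f)) ≡ h ℕ.* b ℕ.+ 2 ℕ.* sum (tabulate w)
length-concat-tabulate {h = zero} f w e = refl
length-concat-tabulate {h = suc h} {b} f w e = begin
  length (f zero ++ concat (tabulate (f ∘ suc))) ≡⟨ length-++ (f zero) ⟩
  length (f zero) ℕ.+ length (concat (tabulate (f ∘ suc))) ≡⟨ cong₂ ℕ._+_ (e zero) (length-concat-tabulate (f ∘ suc) (w ∘ suc) (e ∘ suc)) ⟩
  (b ℕ.+ 2 ℕ.* w zero) ℕ.+ (h ℕ.* b ℕ.+ 2 ℕ.* s) ≡⟨ lemma b (w zero) (h ℕ.* b) s ⟩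
  (b ℕ.+ h ℕ.* b) ℕ.+ 2 ℕ.* (w zero ℕ.+ s) ∎
  where
  open ≡-Reasoning
  s = sum (tabulate (w ∘ suc))
  lemma : ∀ b w x s → (b ℕ.+ 2 ℕ.* w) ℕ.+ (x ℕ.+ 2 ℕ.* s) ≡ (b ℕ.+ x) ℕ.+ 2 ℕ.* (w ℕ.+ s)
  lemma = solve-∀

-- Greedy: each fibre takes as much as it can, up to J, and passes on the rest.
distribute : ∀ J h s → s ≤ h ℕ.* J → Σ (Fin h → Fin (suc J)) λ f → sum (tabulate (toℕ ∘ f)) ≡ s
distribute J zero .0 z≤n = (λ ()) , refl
distribute J (suc h) s s≤ with s ℕ.≤? J
... | yes p with distribute J h 0 z≤n
... | f , e = (λ { zero → fromℕ< (s≤s p) ; (suc q) → f q })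
  , trans (cong₂ ℕ._+_ (Fin.toℕ-fromℕ< (s≤s p)) e) (ℕ.+-identityʳ s)
distribute J (suc h) s s≤ | no ¬p with distribute J h (s ℕ.∸ J) (ℕ.≤-trans (ℕ.∸-monoˡ-≤ J s≤) (ℕ.≤-reflexive (ℕ.m+n∸m≡n J (h ℕ.* J))))
... | f , e = (λ { zero → Fin.fromℕ J ; (suc q) → f q })
  , trans (cong₂ ℕ._+_ (Fin.toℕ-fromℕ J) e) (ℕ.m+[n∸m]≡n (ℕ.<⇒≤ (ℕ.≰⇒> ¬p)))

split : ∀ E S x → x ≤ suc E ℕ.+ 2 ℕ.* S → Σ ℕ λ e → Σ ℕ λ s → e ≤ suc E × s ≤ S × x ≡ e ℕ.+ 2 ℕ.* s
split E zero x x≤ = x , 0 , ℕ.≤-trans x≤ (ℕ.≤-reflexive (ℕ.+-identityʳ (suc E))) , z≤n , ≡.sym (ℕ.+-identityʳ x)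
split E (suc S) 0 x≤ = 0 , 0 , z≤n , z≤n , refl
-- An odd excess ends here; the bound `suc E` guarantees that the core can absorb the 1.
split E (suc S) 1 x≤ = 1 , 0 , s≤s z≤n , z≤n , refl
split E (suc S) (suc (suc x)) x≤ with split E S x (s≤s⁻¹ (s≤s⁻¹ (ℕ.≤-trans x≤ (ℕ.≤-reflexive (lemma E S)))))
  where
  lemma : ∀ E S → suc E ℕ.+ 2 ℕ.* suc S ≡ suc (suc (suc E ℕ.+ 2 ℕ.* S))
  lemma = solve-∀
... | e , s , e≤ , s≤ , refl = e , suc s , e≤ , s≤s s≤ , lemma e s
  where
  lemma : ∀ e s → suc (suc (e ℕ.+ 2 ℕ.* s)) ≡ e ℕ.+ 2 ℕ.* suc s
  lemma = solve-∀

⌈+2*/2⌉ : ∀ m k → ⌈ m ℕ.+ 2 ℕ.* k /2⌉ ≡ ⌈ m /2⌉ ℕ.+ k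
⌈+2*/2⌉ m zero = trans (cong ⌈_/2⌉ (ℕ.+-identityʳ m)) (≡.sym (ℕ.+-identityʳ _))
⌈+2*/2⌉ m (suc k) = trans (cong ⌈_/2⌉ (lemma m k)) (trans (cong suc (⌈+2*/2⌉ m k)) (≡.sym (ℕ.+-suc _ k)))
  where
  lemma : ∀ m k → m ℕ.+ 2 ℕ.* suc k ≡ suc (suc (m ℕ.+ 2 ℕ.* k))
  lemma = solve-∀

-- The gadgets are chosen independently in the fibres, and raising the level j of one gadget by 1 adds two
-- cells; e is the number of cells by which the core exceeds half of its size.
record Scheme {nc J h : ℕ} (L : Latin (Blown nc (4 ℕ.* J) h) (Blown nc (4 ℕ.* J) h) (Blown nc (4 ℕ.* J) h)) (e : ℕ) : Set where
  open Assemble {nc} {4 ℕ.* J} {h}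
  field
    coreRegion : Region (Fin nc)
    genRegion : Region (Fin (4 ℕ.* J))
    core : List (Triple (Fin nc))
    gadget : Fin (suc J) → List (Triple (Fin (4 ℕ.* J)))
    core-length : length core ≡ ⌈ nc /2⌉ ℕ.+ e
    gadget-length : ∀ j → length (gadget j) ≡ 2 ℕ.* J ℕ.+ 2 ℕ.* toℕ j
    core-good : Good coreRegion core
    gadget-good : ∀ j → Good genRegion (gadget j)
    core-valid : All (Valid L ∘ mapTriple inj₁) core
    gadget-valid : ∀ j q → All (Valid L ∘ mapTriple (gen q)) (gadget j)
    blocked : Blocked L (join coreRegion genRegion)

module _ {nc J h : ℕ} (L : Latin (Blown nc (4 ℕ.* J) h) (Blown nc (4 ℕ.* J) h) (Blown nc (4 ℕ.* J) h)) where
  open Assemble {nc} {4 ℕ.* J} {h}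
  open Transport (Blown↔Fin nc (4 ℕ.* J) h) L

  scheme-maximal : ∀ {e s} → Scheme L e → s ≤ h ℕ.* J →
    Σ (List (Cell (nc ℕ.+ h ℕ.* (4 ℕ.* J)))) λ T → IsMaximalPartialTransversal square T × length T ≡ ⌈ nc /2⌉ ℕ.+ e ℕ.+ (h ℕ.* (2 ℕ.* J) ℕ.+ 2 ℕ.* s)
  scheme-maximal {e} {s} σ s≤ with distribute J h s s≤
  ... | f , total = map cell T
    , maximal (assemble-valid {L = L} core-valid (λ q → gadget-valid (f q) q)) (assemble-good core-good (gadget-good ∘ f)) blocked
    , (begin
      length (map cell T) ≡⟨ length-map cell T ⟩
      length T ≡⟨ length-++ (map (mapTriple inj₁) core) ⟩
      length (map (mapTriple inj₁) core) ℕ.+ length (concat (tabulate G)) ≡⟨ cong₂ ℕ._+_ (trans (length-map _ core) core-length)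
        (trans (length-concat-tabulate G (toℕ ∘ f) (λ q → trans (length-map _ (gadget (f q))) (gadget-length (f q)))) (cong (λ s → h ℕ.* (2 ℕ.* J) ℕ.+ 2 ℕ.* s) total)) ⟩
      ⌈ nc /2⌉ ℕ.+ e ℕ.+ (h ℕ.* (2 ℕ.* J) ℕ.+ 2 ℕ.* s) ∎)
    where
    open Scheme σ
    open ≡-Reasoning
    G : Fin h → List (Triple (Blown nc (4 ℕ.* J) h))
    G q = map (mapTriple (gen q)) (gadget (f q))
    T : List (Triple (Blown nc (4 ℕ.* J) h))
    T = assemble core (gadget ∘ f)

  -- Each fibre of 4J points contributes between 2J and 4J cells in steps of two, and the core
  -- between half and all of its points in steps of one. Together these excesses fill the whole
  -- interval from ⌈n/2⌉ to n.
  schemes-omniversal : ∀ {E} → ⌊ nc /2⌋ ≡ suc E → (∀ e → e ≤ suc E → Scheme L e) → Omniversal square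
  schemes-omniversal {E} E≡ σ ℓ lo hi with split E (h ℕ.* J) (ℓ ℕ.∸ base) bound
    where
    base : ℕ
    base = ⌈ nc /2⌉ ℕ.+ h ℕ.* (2 ℕ.* J)
    bound : ℓ ℕ.∸ base ≤ suc E ℕ.+ 2 ℕ.* (h ℕ.* J)
    bound = ℕ.≤-trans (ℕ.∸-monoˡ-≤ base hi) (ℕ.≤-reflexive (trans (cong (ℕ._∸ base) (begin
      nc ℕ.+ h ℕ.* (4 ℕ.* J) ≡⟨ cong (ℕ._+ h ℕ.* (4 ℕ.* J)) (≡.sym (ℕ.⌊n/2⌋+⌈n/2⌉≡n nc)) ⟩
      ⌊ nc /2⌋ ℕ.+ ⌈ nc /2⌉ ℕ.+ h ℕ.* (4 ℕ.* J) ≡⟨ cong (λ k → k ℕ.+ ⌈ nc /2⌉ ℕ.+ h ℕ.* (4 ℕ.* J)) E≡ ⟩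
      suc E ℕ.+ ⌈ nc /2⌉ ℕ.+ h ℕ.* (4 ℕ.* J) ≡⟨ lemma E ⌈ nc /2⌉ h J ⟩
      suc E ℕ.+ 2 ℕ.* (h ℕ.* J) ℕ.+ base ∎)) (ℕ.m+n∸n≡m _ base)))
      where
      open ≡-Reasoning
      lemma : ∀ E c h J → suc E ℕ.+ c ℕ.+ h ℕ.* (4 ℕ.* J) ≡ suc E ℕ.+ 2 ℕ.* (h ℕ.* J) ℕ.+ (c ℕ.+ h ℕ.* (2 ℕ.* J))
      lemma = solve-∀
  ... | e , s , e≤ , s≤ , x≡ with scheme-maximal (σ e e≤) s≤
  ... | T , max , len = T , max , trans len (begin
    ⌈ nc /2⌉ ℕ.+ e ℕ.+ (h ℕ.* (2 ℕ.* J) ℕ.+ 2 ℕ.* s) ≡⟨ lemma ⌈ nc /2⌉ e (h ℕ.* (2 ℕ.* J)) s ⟩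
    base ℕ.+ (e ℕ.+ 2 ℕ.* s) ≡⟨ cong (base ℕ.+_) (≡.sym x≡) ⟩
    base ℕ.+ (ℓ ℕ.∸ base) ≡⟨ ℕ.m+[n∸m]≡n (subst (_≤ ℓ) (trans (cong (λ k → ⌈ nc ℕ.+ k /2⌉) (lemma′ h J)) (⌈+2*/2⌉ nc (h ℕ.* (2 ℕ.* J)))) lo) ⟩
    ℓ ∎)
    where
    open ≡-Reasoning
    base : ℕ
    base = ⌈ nc /2⌉ ℕ.+ h ℕ.* (2 ℕ.* J)
    lemma : ∀ c e x s → c ℕ.+ e ℕ.+ (x ℕ.+ 2 ℕ.* s) ≡ c ℕ.+ x ℕ.+ (e ℕ.+ 2 ℕ.* s)
    lemma = solve-∀
    lemma′ : ∀ h J → h ℕ.* (4 ℕ.* J) ≡ 2 ℕ.* (h ℕ.* (2 ℕ.* J))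
    lemma′ = solve-∀

-- Relabelling and prolongation

reindex : {R C S R′ C′ S′ : Set} {f : R′ → R} {g : C′ → C} {k : S → S′} → (∀ {x y} → f x ≡ f y → x ≡ y) → (∀ {x y} → g x ≡ g y → x ≡ y) →
  (∀ {x y} → k x ≡ k y → x ≡ y) → Latin R C S → Latin R′ C′ S′
reindex {f = f} {g} {k} f-inj g-inj k-inj L = record
  { at = λ r c → k (at L (f r) (g c))
  ; row-injective = λ r → g-inj ∘ row-injective L (f r) ∘ k-inj
  ; col-injective = λ c → f-inj ∘ col-injective L (g c) ∘ k-inj
  }

module _ (A↔B : A ↔ B) where
  open Inverse A↔B using (to; from; strictlyInverseˡ; strictlyInverseʳ)

  ↔-to-injective : ∀ {x y} → to x ≡ to y → x ≡ y
  ↔-to-injective e = trans (≡.sym (strictlyInverseʳ _)) (trans (cong from e) (strictlyInverseʳ _))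

  ↔-from-injective : ∀ {x y} → from x ≡ from y → x ≡ y
  ↔-from-injective e = trans (≡.sym (strictlyInverseˡ _)) (trans (cong to e) (strictlyInverseˡ _))

  pullback : Latin B B B → Latin A A A
  pullback = reindex ↔-to-injective ↔-to-injective ↔-from-injective

Idempotent : Latin A A A → Set
Idempotent N = ∀ x → at N x x ≡ x

pullback-idempotent : (A↔B : A ↔ B) {N : Latin B B B} → Idempotent N → Idempotent (pullback A↔B N)
pullback-idempotent A↔B idem x = trans (cong from (idem (to x))) (strictlyInverseʳ x)
  where open Inverse A↔B

Maybe↔Fin : ∀ {n} → A ↔ Fin n → Maybe A ↔ Fin (suc n)
Maybe↔Fin {A = A} {n} A↔ = mk↔ₛ′ f g f∘g g∘f
  where
  open Inverse A↔
  f : Maybe A → Fin (suc n)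
  f nothing = zero
  f (just x) = suc (to x)
  g : Fin (suc n) → Maybe A
  g zero = nothing
  g (suc i) = just (from i)
  f∘g : ∀ i → f (g i) ≡ i
  f∘g zero = refl
  f∘g (suc i) = cong suc (strictlyInverseˡ i)
  g∘f : ∀ x → g (f x) ≡ x
  g∘f nothing = refl
  g∘f (just x) = cong just (strictlyInverseʳ x)

injective⇒onto : ∀ {n} (f : Fin n → Fin n) → (∀ {i j} → f i ≡ f j → i ≡ j) → ∀ j → ∃ λ i → f i ≡ j
injective⇒onto {suc n} f inj j with Fin.any? (λ i → f i Fin.≟ j)
... | yes p = p
... | no ¬p = contradiction (Fin.injective⇒≤ {f = λ i → punchOut (miss i)}
    (λ e → inj (Fin.punchOut-injective (miss _) (miss _) e))) ℕ.1+n≰n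
  where
  miss : ∀ i → j ≢ f i
  miss i e = ¬p (i , ≡.sym e)

-- This spares an explicit inverse when points are numbered by residues that are only known to be
-- distinct.
injective⇒↔ : ∀ {n} → A ↔ Fin n → (f : A → Fin n) → (∀ {x y} → f x ≡ f y → x ≡ y) → A ↔ Fin n
injective⇒↔ A↔ f inj = mk↔ₛ′ f (λ j → from (proj₁ (onto j))) (λ j → proj₂ (onto j))
  (λ x → inj (proj₂ (onto (f x))))
  where
  open Inverse A↔
  onto : ∀ j → ∃ λ i → f (from i) ≡ j
  onto = injective⇒onto (f ∘ from) (↔-from-injective A↔ ∘ inj)

-- The classical prolongation along the transversal of cells (x , θ x), which `diagonal` says have
-- distinct symbols: their symbols move to a new row and a new column, and the new symbol `nothing`
-- takes their place and the corner.
module Prolong {X : Set} (N : Latin X X X) (_≟_ : DecidableEquality X) (θ θ⁻¹ : X → X)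
  (θ∘θ⁻¹ : ∀ x → θ (θ⁻¹ x) ≡ x) (θ⁻¹∘θ : ∀ x → θ⁻¹ (θ x) ≡ x)
  (diagonal : ∀ {x y} → at N x (θ x) ≡ at N y (θ y) → x ≡ y) where

  pick : ∀ {x y} → Dec (y ≡ θ x) → Maybe X
  pick (yes _) = nothing
  pick {x} {y} (no _) = just (at N x y)

  op : Maybe X → Maybe X → Maybe X
  op (just x) (just y) = pick {x} {y} (y ≟ θ x)
  op (just x) nothing = just (at N x (θ x))
  op nothing (just y) = just (at N (θ⁻¹ y) y)
  op nothing nothing = nothing

  op-on : ∀ {x y} → y ≡ θ x → op (just x) (just y) ≡ nothing
  op-on {x} {y} e with y ≟ θ x
  ... | yes _ = refl
  ... | no ne = contradiction e ne

  op-off : ∀ {x y} → y ≢ θ x → op (just x) (just y) ≡ just (at N x y)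
  op-off {x} {y} ne with y ≟ θ x
  ... | yes e = contradiction e ne
  ... | no _ = refl

  private
    edge : ∀ y → at N (θ⁻¹ y) y ≡ at N (θ⁻¹ y) (θ (θ⁻¹ y))
    edge y = cong (at N (θ⁻¹ y)) (≡.sym (θ∘θ⁻¹ y))

    θ⁻¹-injective : ∀ {x y} → θ⁻¹ x ≡ θ⁻¹ y → x ≡ y
    θ⁻¹-injective e = trans (≡.sym (θ∘θ⁻¹ _)) (trans (cong θ e) (θ∘θ⁻¹ _))

    θ-injective : ∀ {x y} → θ x ≡ θ y → x ≡ y
    θ-injective e = trans (≡.sym (θ⁻¹∘θ _)) (trans (cong θ⁻¹ e) (θ⁻¹∘θ _))

    row-inj : ∀ r {c c′} → op r c ≡ op r c′ → c ≡ c′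
    row-inj (just x) {just y} {just y′} e with y ≟ θ x | y′ ≟ θ x
    ... | yes p | yes p′ = cong just (trans p (≡.sym p′))
    ... | no _ | no _ = cong just (row-injective N x (just-injective e))
    row-inj (just x) {just y} {nothing} e with y ≟ θ x
    ... | no ne = contradiction (row-injective N x (just-injective e)) ne
    row-inj (just x) {nothing} {just y} e with y ≟ θ x
    ... | no ne = contradiction (≡.sym (row-injective N x (just-injective e))) ne
    row-inj (just x) {nothing} {nothing} e = refl
    row-inj nothing {just y} {just y′} e = cong just (θ⁻¹-injective
      (diagonal (trans (≡.sym (edge y)) (trans (just-injective e) (edge y′)))))
    row-inj nothing {nothing} {nothing} e = refl

    col-inj : ∀ c {r r′} → op r c ≡ op r′ c → r ≡ r′
    col-inj (just y) {just x} {just x′} e with y ≟ θ x | y ≟ θ x′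
    ... | yes p | yes p′ = cong just (θ-injective (trans (≡.sym p) p′))
    ... | no _ | no _ = cong just (col-injective N y (just-injective e))
    col-inj (just y) {just x} {nothing} e with y ≟ θ x
    ... | no ne = contradiction (trans (≡.sym (θ∘θ⁻¹ y)) (cong θ (≡.sym (col-injective N y (just-injective e))))) ne
    col-inj (just y) {nothing} {just x} e with y ≟ θ x
    ... | no ne = contradiction (trans (≡.sym (θ∘θ⁻¹ y)) (cong θ (col-injective N y (just-injective e)))) ne
    col-inj (just y) {nothing} {nothing} e = refl
    col-inj nothing {just x} {just x′} e = cong just (diagonal (just-injective e))
    col-inj nothing {nothing} {nothing} e = refl

  prolongation : Latin (Maybe X) (Maybe X) (Maybe X)
  prolongation = record { at = op ; row-injective = row-inj ; col-injective = col-inj }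

-- Congruences, and averages modulo an odd number

-- The modulus appears both as a natural number and as an integer expression `M`, such as 1 + 2P, so
-- that congruences reduce to polynomial identities in which its form can be used.
module Residue (k : ℕ) .{{_ : ℕ.NonZero k}} (M : ℤ) (M≡k : M ≡ + k) where
  open import Data.Integer using (_+_; _*_; -_; _-_)

  infix 4 _≈_
  record _≈_ (a b : ℤ) : Set where
    constructor _,_
    field
      quotient : ℤ
      equation : a - b ≡ quotient * M

  abstract
    val : Fin k → ℤ
    val x = + toℕ x

    res : ℤ → Fin k
    res a = fromℕ< (n%ℕd<d a k)

    val≡toℕ : ∀ x → val x ≡ + toℕ x
    val≡toℕ x = refl

  -- The coefficients `c` and `d` are a certificate: the new difference is a combination of the old
  -- one and the modulus, an identity that the ring solver verifies.
  ≈-linear : ∀ c d {a b a′ b′} → a′ - b′ ≡ c * (a - b) + d * M → a ≈ b → a′ ≈ b′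
  ≈-linear c d e (q , eq) = c * q + d , trans e (trans (cong (λ z → c * z + d * M) eq) (lemma c q d M))
    where
    lemma : ∀ c q d M → c * (q * M) + d * M ≡ (c * q + d) * M
    lemma = solveℤ-∀

  ≈-linear₂ : ∀ c₁ c₂ d {a₁ b₁ a₂ b₂ a′ b′} → a′ - b′ ≡ c₁ * (a₁ - b₁) + c₂ * (a₂ - b₂) + d * M → a₁ ≈ b₁ → a₂ ≈ b₂ → a′ ≈ b′
  ≈-linear₂ c₁ c₂ d e (q₁ , eq₁) (q₂ , eq₂) = c₁ * q₁ + c₂ * q₂ + d
    , trans e (trans (cong₂ (λ y z → c₁ * y + c₂ * z + d * M) eq₁ eq₂) (lemma c₁ q₁ c₂ q₂ d M))
    where
    lemma : ∀ c₁ q₁ c₂ q₂ d M → c₁ * (q₁ * M) + c₂ * (q₂ * M) + d * M ≡ (c₁ * q₁ + c₂ * q₂ + d) * M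
    lemma = solveℤ-∀

  ≈-refl : ∀ {a} → a ≈ a
  ≈-refl {a} = 0ℤ , ℤ.+-inverseʳ a

  ≈-reflexive : ∀ {a b} → a ≡ b → a ≈ b
  ≈-reflexive refl = ≈-refl

  ≈-sym : ∀ {a b} → a ≈ b → b ≈ a
  ≈-sym {a} {b} = ≈-linear (ℤ.-1ℤ) 0ℤ (lemma a b M)
    where
    lemma : ∀ a b M → b - a ≡ ℤ.-1ℤ * (a - b) + 0ℤ * M
    lemma = solveℤ-∀

  ≈-trans : ∀ {a b c} → a ≈ b → b ≈ c → a ≈ c
  ≈-trans {a} {b} {c} = ≈-linear₂ 1ℤ 1ℤ 0ℤ (lemma a b c M)
    where
    lemma : ∀ a b c M → a - c ≡ 1ℤ * (a - b) + 1ℤ * (b - c) + 0ℤ * M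
    lemma = solveℤ-∀

  abstract
    val-res : ∀ a → val (res a) ≈ a
    val-res a = - (a /ℕ k) , (begin
      val (res a) - a ≡⟨ cong₂ (λ x y → + x - y) (Fin.toℕ-fromℕ< (n%ℕd<d a k)) (a≡a%ℕn+[a/ℕn]*n a k) ⟩
      + (a %ℕ k) - (+ (a %ℕ k) + (a /ℕ k) * + k) ≡⟨ lemma (+ (a %ℕ k)) (a /ℕ k) (+ k) ⟩
      - (a /ℕ k) * + k ≡⟨ cong (- (a /ℕ k) *_) (≡.sym M≡k) ⟩
      - (a /ℕ k) * M ∎)
      where
      open ≡-Reasoning
      lemma : ∀ r q k → r - (r + q * k) ≡ - q * k
      lemma = solveℤ-∀

  ≈-bounded : ∀ {a b} → ∣ a - b ∣ ℕ.< k → a ≈ b → a ≡ b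
  ≈-bounded {a} {b} lt (q , eq) = ℤ.i-j≡0⇒i≡j a b (trans eq (trans (cong (_* M) q≡0) (ℤ.*-zeroˡ M)))
    where
    abs : ∣ a - b ∣ ≡ ∣ q ∣ ℕ.* k
    abs = trans (cong ∣_∣ (trans eq (cong (q *_) M≡k))) (ℤ.abs-* q (+ k))
    zero-abs : ∀ m → m ℕ.* k ℕ.< k → m ≡ 0
    zero-abs zero _ = refl
    zero-abs (suc m) lt = contradiction lt (ℕ.≤⇒≯ (ℕ.m≤m+n k (m ℕ.* k)))
    q≡0 : q ≡ 0ℤ
    q≡0 = ℤ.∣i∣≡0⇒i≡0 (zero-abs ∣ q ∣ (subst (ℕ._< k) abs lt))

  nat-≈-injective : ∀ {m n} → m ℕ.< k → n ℕ.< k → + m ≈ + n → m ≡ n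
  nat-≈-injective {m} {n} m<k n<k e = ℤ.+-injective (≈-bounded {+ m} {+ n}
    (ℕ.≤-<-trans (subst (ℕ._≤ m ℕ.⊔ n) (cong ∣_∣ (≡.sym (ℤ.m-n≡m⊖n m n))) (ℤ.∣m⊝n∣≤m⊔n m n)) (ℕ.⊔-lub m<k n<k)) e)

  val-≈-injective : ∀ {x y} → val x ≈ val y → x ≡ y
  val-≈-injective {x} {y} e = Fin.toℕ-injective (nat-≈-injective (Fin.toℕ<n x) (Fin.toℕ<n y)
    (subst₂ _≈_ (val≡toℕ x) (val≡toℕ y) e))

  res-cong : ∀ {a b} → a ≈ b → res a ≡ res b
  res-cong {a} {b} e = val-≈-injective (≈-trans (val-res a) (≈-trans e (≈-sym (val-res b))))

  res-injective : ∀ {a b} → res a ≡ res b → a ≈ b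
  res-injective {a} {b} e = ≈-trans (≈-sym (val-res a)) (≈-trans (≈-reflexive (cong val e)) (val-res b))

  res≡ : ∀ {a x} → a ≈ val x → res a ≡ x
  res≡ {a} {x} e = val-≈-injective (≈-trans (val-res a) e)

module OddResidue (p : ℕ) (k : ℕ) .{{_ : ℕ.NonZero k}} (k≡ : + k ≡ 1ℤ ℤ.+ + 2 ℤ.* + p) where
  open import Data.Integer using (_+_; _*_; -_; _-_)
  private
    P : ℤ
    P = + p
  open Residue k (1ℤ + + 2 * P) (≡.sym k≡) public

  -- This is (x + y)/2, since P + 1 is the inverse of 2 modulo 1 + 2P.
  average : Latin (Fin k) (Fin k) (Fin k)
  average = record
    { at = λ x y → res ((P + 1ℤ) * (val x + val y))
    ; row-injective = λ x {y} {y′} e → val-≈-injective (≈-linear (+ 2) (- (val y - val y′)) (rowLemma P (val x) (val y) (val y′)) (res-injective e))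
    ; col-injective = λ y {x} {x′} e → val-≈-injective (≈-linear (+ 2) (- (val x - val x′)) (colLemma P (val y) (val x) (val x′)) (res-injective e))
    }
    where
    rowLemma : ∀ P x y y′ → y - y′ ≡ + 2 * ((P + 1ℤ) * (x + y) - (P + 1ℤ) * (x + y′)) + (- (y - y′)) * (1ℤ + + 2 * P)
    rowLemma = solveℤ-∀
    colLemma : ∀ P y x x′ → x - x′ ≡ + 2 * ((P + 1ℤ) * (x + y) - (P + 1ℤ) * (x′ + y)) + (- (x - x′)) * (1ℤ + + 2 * P)
    colLemma = solveℤ-∀

  average≡ : ∀ {x y z} → val x + val y ≈ + 2 * val z → at average x y ≡ z
  average≡ {x} {y} {z} = res≡ ∘ ≈-linear (P + 1ℤ) (val z) (lemma P (val x) (val y) (val z))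
    where
    lemma : ∀ P x y z → (P + 1ℤ) * (x + y) - z ≡ (P + 1ℤ) * (x + y - + 2 * z) + z * (1ℤ + + 2 * P)
    lemma = solveℤ-∀

  average-idempotent : Idempotent average
  average-idempotent x = average≡ (≈-reflexive (lemma (val x)))
    where
    lemma : ∀ x → x + x ≡ + 2 * x
    lemma = solveℤ-∀

  average-value : ∀ x y → + 2 * val (at average x y) ≈ val x + val y
  average-value x y = ≈-linear (+ 2) (val x + val y) (lemma P (val x) (val y) (val (at average x y))) (val-res _)
    where
    lemma : ∀ P x y v → + 2 * v - (x + y) ≡ + 2 * (v - (P + 1ℤ) * (x + y)) + (x + y) * (1ℤ + + 2 * P)
    lemma = solveℤ-∀

  shift : ℤ → Fin k → Fin k
  shift s x = res (val x + s)

  shift≡ : ∀ {s x y} → val x + s ≈ val y → shift s x ≡ y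
  shift≡ = res≡

  shift-shift : ∀ s t x → shift s (shift t x) ≡ shift (s + t) x
  shift-shift s t x = res-cong (≈-linear 1ℤ 0ℤ (lemma (val x) s t (val (shift t x)) (1ℤ + + 2 * P)) (val-res (val x + t)))
    where
    lemma : ∀ x s t y M → (y + s) - (x + (s + t)) ≡ 1ℤ * (y - (x + t)) + 0ℤ * M
    lemma = solveℤ-∀

  shift-0 : ∀ x → shift 0ℤ x ≡ x
  shift-0 x = shift≡ (≈-reflexive (ℤ.+-identityʳ (val x)))

  shift-inverse : ∀ s x → shift s (shift (- s) x) ≡ x
  shift-inverse s x = trans (shift-shift s (- s) x) (trans (cong (λ t → shift t x) (ℤ.+-inverseʳ s)) (shift-0 x))

  shift-inverse′ : ∀ s x → shift (- s) (shift s x) ≡ x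
  shift-inverse′ s x = trans (shift-shift (- s) s x) (trans (cong (λ t → shift t x) (ℤ.+-inverseˡ s)) (shift-0 x))

  -- Along y = x + s the entry is x + s/2, so every broken diagonal is a transversal and can be used
  -- for prolongation.
  average-shift-injective : ∀ s {x y} → at average x (shift s x) ≡ at average y (shift s y) → x ≡ y
  average-shift-injective s {x} {y} e = val-≈-injective (≈-linear (P + 1ℤ) (- (val x - val y)) (lemma₂ P (val x) (val y) s)
    (≈-trans (half x) (≈-trans (≈-reflexive (cong (λ z → + 2 * val z) e)) (≈-sym (half y)))))
    where
    half : ∀ x → + 2 * val x + s ≈ + 2 * val (at average x (shift s x))
    half x = ≈-linear₂ ℤ.-1ℤ ℤ.-1ℤ 0ℤ (lemma (val x) s (val (shift s x)) (val (at average x (shift s x))) (1ℤ + + 2 * P))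
      (average-value x (shift s x)) (val-res (val x + s))
      where
      lemma : ∀ x s y v M → + 2 * x + s - + 2 * v ≡ ℤ.-1ℤ * (+ 2 * v - (x + y)) + ℤ.-1ℤ * (y - (x + s)) + 0ℤ * M
      lemma = solveℤ-∀
    lemma₂ : ∀ P x y s → x - y ≡ (P + 1ℤ) * ((+ 2 * x + s) - (+ 2 * y + s)) + (- (x - y)) * (1ℤ + + 2 * P)
    lemma₂ = solveℤ-∀

  shift-miss : ∀ {s x y} d → (val x + s) - val y ≡ d → d ≢ 0ℤ → ∣ d ∣ ℕ.< k → y ≢ shift s x
  shift-miss {s} {x} {y} d e d≢0 lt refl = d≢0 (trans (≡.sym e) (ℤ.i≡j⇒i-j≡0 (≈-bounded {val x + s} {val (shift s x)}
    (subst (λ z → ∣ z ∣ ℕ.< k) (≡.sym e) lt) (≈-sym (val-res _)))))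

-- Odd order: the square [A B; C D]

isLeft : {A B : Set} → A ⊎ B → Bool
isLeft (inj₁ _) = true
isLeft (inj₂ _) = false

module Odd {c h : ℕ} where
  P : Set
  P = Blown c 2 h

  -- The first summand indexes the rows and columns of A and is one larger than the second, which
  -- indexes D and contains all missed rows and columns.
  W : Set
  W = Maybe P ⊎ P

  V : Set
  V = Blown (suc c ℕ.+ c) 4 h

  private
    decCore : Fin (suc c) ⊎ Fin c → W
    decCore (inj₁ zero) = inj₁ nothing
    decCore (inj₁ (suc a)) = inj₁ (just (inj₁ a))
    decCore (inj₂ a) = inj₂ (inj₁ a)

    decGen : Fin h → Fin 2 ⊎ Fin 2 → W
    decGen q (inj₁ b) = inj₁ (just (inj₂ (q , b)))
    decGen q (inj₂ b) = inj₂ (inj₂ (q , b))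

  dec : V → W
  dec (inj₁ i) = decCore (splitAt (suc c) i)
  dec (inj₂ (q , i)) = decGen q (splitAt 2 i)

  enc : W → V
  enc (inj₁ nothing) = inj₁ (zero ↑ˡ c)
  enc (inj₁ (just (inj₁ a))) = inj₁ (suc a ↑ˡ c)
  enc (inj₁ (just (inj₂ (q , b)))) = inj₂ (q , b ↑ˡ 2)
  enc (inj₂ (inj₁ a)) = inj₁ (suc c ↑ʳ a)
  enc (inj₂ (inj₂ (q , b))) = inj₂ (q , 2 ↑ʳ b)

  private
    encCore : ∀ s → enc (decCore s) ≡ inj₁ (Fin.join (suc c) c s)
    encCore (inj₁ zero) = refl
    encCore (inj₁ (suc a)) = refl
    encCore (inj₂ a) = refl

    encGen : ∀ q s → enc (decGen q s) ≡ inj₂ (q , Fin.join 2 2 s)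
    encGen q (inj₁ b) = refl
    encGen q (inj₂ b) = refl

    enc∘dec : ∀ v → enc (dec v) ≡ v
    enc∘dec (inj₁ i) = trans (encCore (splitAt (suc c) i)) (cong inj₁ (Fin.join-splitAt (suc c) c i))
    enc∘dec (inj₂ (q , i)) = trans (encGen q (splitAt 2 i)) (cong (λ j → inj₂ (q , j)) (Fin.join-splitAt 2 2 i))

    dec∘enc : ∀ w → dec (enc w) ≡ w
    dec∘enc (inj₁ nothing) = refl
    dec∘enc (inj₁ (just (inj₁ a))) = cong decCore (Fin.splitAt-↑ˡ (suc c) (suc a) c)
    dec∘enc (inj₁ (just (inj₂ (q , b)))) = cong (decGen q) (Fin.splitAt-↑ˡ 2 b 2)
    dec∘enc (inj₂ (inj₁ a)) = cong decCore (Fin.splitAt-↑ʳ (suc c) c a)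
    dec∘enc (inj₂ (inj₂ (q , b))) = cong (decGen q) (Fin.splitAt-↑ʳ 2 2 b)

  V↔W : V ↔ W
  V↔W = mk↔ₛ′ dec enc dec∘enc enc∘dec

  coreRegion : Region (Fin (suc c ℕ.+ c))
  coreRegion = region (isLeft ∘ splitAt (suc c)) (isLeft ∘ splitAt (suc c)) (not ∘ isLeft ∘ splitAt (suc c))

  genRegion : Region (Fin 4)
  genRegion = region (isLeft ∘ splitAt 2) (isLeft ∘ splitAt 2) (not ∘ isLeft ∘ splitAt 2)

  open Assemble {suc c ℕ.+ c} {4} {h} using (join)

  private
    left-core : ∀ s → isLeft s ≡ isLeft (decCore s)
    left-core (inj₁ zero) = refl
    left-core (inj₁ (suc a)) = refl
    left-core (inj₂ a) = refl

    left-gen : ∀ q s → isLeft s ≡ isLeft (decGen q s)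
    left-gen q (inj₁ b) = refl
    left-gen q (inj₂ b) = refl

    left-row : ∀ v → rows (join coreRegion genRegion) v ≡ isLeft (dec v)
    left-row (inj₁ i) = left-core (splitAt (suc c) i)
    left-row (inj₂ (q , i)) = left-gen q (splitAt 2 i)

    left-col : ∀ v → cols (join coreRegion genRegion) v ≡ isLeft (dec v)
    left-col (inj₁ i) = left-core (splitAt (suc c) i)
    left-col (inj₂ (q , i)) = left-gen q (splitAt 2 i)

    right-sym : ∀ v → syms (join coreRegion genRegion) v ≡ not (isLeft (dec v))
    right-sym (inj₁ i) = cong not (left-core (splitAt (suc c) i))
    right-sym (inj₂ (q , i)) = cong not (left-gen q (splitAt 2 i))

  -- The square [A B; C D]: D is a subsquare, B and C lose the column and row nothing,
  -- and the entries nothing of A are replaced by what was lost.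
  module Construction (Â B̂ Ĉ : Latin (Maybe P) (Maybe P) (Maybe P)) (D : Latin P P P)
    (match : ∀ x y → at Â x y ≡ nothing → at B̂ x nothing ≡ at Ĉ nothing y) where

    private
      fill : Maybe P → Maybe P → W
      fill x (just s) = inj₂ s
      fill x nothing = inj₁ (at B̂ x nothing)

    op : W → W → W
    op (inj₁ x) (inj₁ y) = fill x (at Â x y)
    op (inj₁ x) (inj₂ y) = inj₁ (at B̂ x (just y))
    op (inj₂ x) (inj₁ y) = inj₁ (at Ĉ (just x) y)
    op (inj₂ x) (inj₂ y) = inj₂ (at D x y)

    private
      row-inj : ∀ r {y y′} → op r y ≡ op r y′ → y ≡ y′
      row-inj (inj₁ x) {inj₁ y} {inj₁ y′} e with at Â x y in p | at Â x y′ in p′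
      ... | just s | just s′ = cong inj₁ (row-injective Â x (trans p (trans (cong just (inj₂-injective e)) (≡.sym p′))))
      ... | nothing | nothing = cong inj₁ (row-injective Â x (trans p (≡.sym p′)))
      row-inj (inj₁ x) {inj₁ y} {inj₂ y′} e with at Â x y
      ... | nothing = contradiction (row-injective B̂ x (inj₁-injective e)) λ ()
      row-inj (inj₁ x) {inj₂ y} {inj₁ y′} e with at Â x y′
      ... | nothing = contradiction (row-injective B̂ x (inj₁-injective e)) λ ()
      row-inj (inj₁ x) {inj₂ y} {inj₂ y′} e = cong inj₂ (just-injective (row-injective B̂ x (inj₁-injective e)))
      row-inj (inj₂ x) {inj₁ y} {inj₁ y′} e = cong inj₁ (row-injective Ĉ (just x) (inj₁-injective e))
      row-inj (inj₂ x) {inj₂ y} {inj₂ y′} e = cong inj₂ (row-injective D x (inj₂-injective e))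

      col-inj : ∀ c {x x′} → op x c ≡ op x′ c → x ≡ x′
      col-inj (inj₁ y) {inj₁ x} {inj₁ x′} e with at Â x y in p | at Â x′ y in p′
      ... | just s | just s′ = cong inj₁ (col-injective Â y (trans p (trans (cong just (inj₂-injective e)) (≡.sym p′))))
      ... | nothing | nothing = cong inj₁ (col-injective Â y (trans p (≡.sym p′)))
      col-inj (inj₁ y) {inj₁ x} {inj₂ x′} e with at Â x y in p
      -- The filled-in symbol is the one that row x of B lost; by `match` column y of C lost the
      -- same symbol, so it does not recur below.
      ... | nothing = contradiction (col-injective Ĉ y (trans (≡.sym (match x y p)) (inj₁-injective e))) λ ()
      col-inj (inj₁ y) {inj₂ x} {inj₁ x′} e with at Â x′ y in p
      ... | nothing = contradiction (col-injective Ĉ y (trans (inj₁-injective e) (match x′ y p))) λ ()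
      col-inj (inj₁ y) {inj₂ x} {inj₂ x′} e = cong inj₂ (just-injective (col-injective Ĉ y (inj₁-injective e)))
      col-inj (inj₂ y) {inj₁ x} {inj₁ x′} e = cong inj₁ (col-injective B̂ (just y) (inj₁-injective e))
      col-inj (inj₂ y) {inj₂ x} {inj₂ x′} e = cong inj₂ (col-injective D y (inj₂-injective e))

    L : Latin V V V
    L = pullback V↔W (record { at = op ; row-injective = row-inj ; col-injective = col-inj })

    cellA : ∀ {x y s} → at Â x y ≡ just s → enc (op (inj₁ x) (inj₁ y)) ≡ enc (inj₂ s)
    cellA {x} e = cong (enc ∘ fill x) e

    cellA∞ : ∀ {x y s} → at Â x y ≡ nothing → at B̂ x nothing ≡ s → enc (op (inj₁ x) (inj₁ y)) ≡ enc (inj₁ s)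
    cellA∞ {x} e e′ = trans (cong (enc ∘ fill x) e) (cong (enc ∘ inj₁) e′)

    cellBC : ∀ {s s′} → s ≡ s′ → enc (inj₁ s) ≡ enc (inj₁ s′)
    cellBC = cong (enc ∘ inj₁)

    cellD : ∀ {s s′} → s ≡ s′ → enc (inj₂ s) ≡ enc (inj₂ s′)
    cellD = cong (enc ∘ inj₂)

    blocked : Blocked L (join coreRegion genRegion)
    blocked v w r≡ c≡ with dec v | left-row v | dec w | left-col w
    ... | inj₁ _ | e | _ | _ = contradiction (trans (≡.sym r≡) e) λ ()
    ... | inj₂ _ | _ | inj₁ _ | e = contradiction (trans (≡.sym c≡) e) λ ()
    ... | inj₂ x | _ | inj₂ y | _ = trans (right-sym (enc (inj₂ (at D x y)))) (cong (not ∘ isLeft) (dec∘enc (inj₂ (at D x y))))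

    module Schemes
      (A-gen : ∀ q b → at Â (just (inj₂ (q , b))) (just (inj₂ (q , b))) ≡ just (inj₂ (q , b)))
      (B-gen : ∀ q → at B̂ (just (inj₂ (q , 0F))) (just (inj₂ (q , 0F))) ≡ just (inj₂ (q , 0F)))
      (C-gen : ∀ q → at Ĉ (just (inj₂ (q , 0F))) (just (inj₂ (q , 0F))) ≡ just (inj₂ (q , 1F)))
      (D-gen : ∀ q → at D (inj₂ (q , 1F)) (inj₂ (q , 1F)) ≡ inj₂ (q , 0F)) where

      -- Raising the level trades the A cell over point 0 for one cell each of B, C and D. The B and
      -- C cells keep row 0 and column 0 covered, and the D cell supplies the symbol 2 of the
      -- abandoned cell.
      gadget : Fin 2 → List (Triple (Fin 4))
      gadget 0F = (0F , 0F , 2F) ∷ (1F , 1F , 3F) ∷ []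
      gadget 1F = (1F , 1F , 3F) ∷ (0F , 2F , 0F) ∷ (2F , 0F , 1F) ∷ (3F , 3F , 2F) ∷ []

      scheme : ∀ {e} (core : List (Triple (Fin (suc c ℕ.+ c)))) → length core ≡ ⌈ suc c ℕ.+ c /2⌉ ℕ.+ e →
        does (good? coreRegion core) ≡ true → All (Valid L ∘ mapTriple inj₁) core → Scheme {J = 1} {h = h} L e
      scheme core len good valid = record
        { coreRegion = coreRegion
        ; genRegion = genRegion
        ; core = core
        ; gadget = gadget
        ; core-length = len
        ; gadget-length = λ { 0F → refl ; 1F → refl }
        ; core-good = good! coreRegion core good
        ; gadget-good = λ { 0F → good! genRegion (gadget 0F) refl ; 1F → good! genRegion (gadget 1F) refl }
        ; core-valid = valid
        ; gadget-valid = λ { 0F q → cellA (A-gen q 0F) ∷ cellA (A-gen q 1F) ∷ []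
                           ; 1F q → cellA (A-gen q 1F) ∷ cellBC (B-gen q) ∷ cellBC (C-gen q) ∷ cellD (D-gen q) ∷ [] }
        ; blocked = blocked
        }

module Enumerate (c h : ℕ) where
  std : Blown c 2 h ↔ Fin (c ℕ.+ h ℕ.* 2)
  std = Blown↔Fin c 2 h

  open Inverse std public using (to; from; strictlyInverseʳ)

  toℕ-core : ∀ i → toℕ (to (inj₁ i)) ≡ toℕ i
  toℕ-core i = Fin.toℕ-↑ˡ i (h ℕ.* 2)

  toℕ-gen : ∀ q b → toℕ (to (inj₂ (q , b))) ≡ c ℕ.+ (2 ℕ.* toℕ q ℕ.+ toℕ b)
  toℕ-gen q b = trans (Fin.toℕ-↑ʳ c (Fin.combine q b)) (cong (c ℕ.+_) (Fin.toℕ-combine q b))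

-- Order 1 modulo 4

-- Modulo k = (n+1)/2, with A(x,y) = (x+y)/2, B(x,y) = 2x − y, C(x,y) = x − 2y and nothing standing for 0.
-- The fibres are the pairs {x, −x}.
module OneModFour (h : ℕ) where
  open import Data.Integer using (_+_; _*_; -_; _-_)
  open Odd {2} {h} using (P)
  open Enumerate 2 h

  m : ℕ
  m = 2 ℕ.+ h ℕ.* 2

  private
    m+1-odd : ∀ h → + (suc (2 ℕ.+ h ℕ.* 2)) ≡ 1ℤ + + 2 * + suc h
    m+1-odd h = trans (cong +_ (lemma h)) (cong (λ z → 1ℤ + z) (ℤ.pos-* 2 (suc h)))
      where
      lemma : ∀ h → suc (2 ℕ.+ h ℕ.* 2) ≡ 1 ℕ.+ 2 ℕ.* suc h
      lemma = solve-∀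

  open OddResidue (suc h) (suc m) (m+1-odd h)

  pair : P → ℕ
  pair (inj₁ b) = 0
  pair (inj₂ (q , b)) = suc (toℕ q)

  side : P → Fin 2
  side (inj₁ b) = b
  side (inj₂ (q , b)) = b

  pair-side : ∀ {x y} → pair x ≡ pair y → side x ≡ side y → x ≡ y
  pair-side {inj₁ _} {inj₁ _} refl refl = refl
  pair-side {inj₂ (q , b)} {inj₂ (q′ , .b)} e refl = cong (λ q → inj₂ (q , b)) (Fin.toℕ-injective (ℕ.suc-injective e))

  pair≤ : ∀ x → pair x ℕ.≤ h
  pair≤ (inj₁ b) = z≤n
  pair≤ (inj₂ (q , b)) = Fin.toℕ<n q

  signed : Fin 2 → ℕ → ℤ
  signed 0F t = + suc t
  signed 1F t = -[1+ t ]

  -- The two core points become 1 and -1 and fibre q becomes the pair of q + 2 and its negative. All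
  -- absolute values are at most h + 1, so the codes are distinct modulo 2h + 3.
  code : Maybe P → ℤ
  code nothing = 0ℤ
  code (just x) = signed (side x) (pair x)

  private
    signed-injective : ∀ {b b′ t t′} → signed b t ≡ signed b′ t′ → t ≡ t′ × b ≡ b′
    signed-injective {0F} {0F} refl = refl , refl
    signed-injective {0F} {1F} ()
    signed-injective {1F} {0F} ()
    signed-injective {1F} {1F} refl = refl , refl

    signed≢0 : ∀ b {t} → signed b t ≢ 0ℤ
    signed≢0 0F ()
    signed≢0 1F ()

    ∣signed∣ : ∀ b t → ∣ signed b t ∣ ≡ suc t
    ∣signed∣ 0F t = refl
    ∣signed∣ 1F t = refl

    code-injective : ∀ {x y} → code x ≡ code y → x ≡ y
    code-injective {nothing} {nothing} _ = refl
    code-injective {nothing} {just y} e = contradiction (≡.sym e) (signed≢0 (side y))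
    code-injective {just x} {nothing} e = contradiction e (signed≢0 (side x))
    code-injective {just x} {just y} e with signed-injective {side x} {side y} e
    ... | p , s = cong just (pair-side p s)

    ∣code∣≤ : ∀ x → ∣ code x ∣ ℕ.≤ suc h
    ∣code∣≤ nothing = z≤n
    ∣code∣≤ (just x) = subst (ℕ._≤ suc h) (≡.sym (∣signed∣ (side x) (pair x))) (s≤s (pair≤ x))

    res-code-injective : ∀ {x y} → res (code x) ≡ res (code y) → x ≡ y
    res-code-injective {x} {y} e = code-injective (≈-bounded {code x} {code y}
      (s≤s (ℕ.≤-trans (ℤ.∣i-j∣≤∣i∣+∣j∣ (code x) (code y)) (ℕ.≤-trans (ℕ.+-mono-≤ (∣code∣≤ x) (∣code∣≤ y)) (ℕ.≤-reflexive (lemma h)))))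
      (res-injective e))
      where
      lemma : ∀ h → suc h ℕ.+ suc h ≡ 2 ℕ.+ h ℕ.* 2
      lemma = solve-∀

  abstract
    ι : Maybe P ↔ Fin (suc m)
    ι = injective⇒↔ (Maybe↔Fin std) (res ∘ code) res-code-injective

    ι≡ : ∀ x → Inverse.to ι x ≡ res (code x)
    ι≡ x = refl

  private
    bilinear : (a b : ℤ) → (∀ {x y y′} → (a * val x + b * val y) ≈ (a * val x + b * val y′) → val y ≈ val y′) →
      (∀ {x x′ y} → (a * val x + b * val y) ≈ (a * val x′ + b * val y) → val x ≈ val x′) → Latin (Fin (suc m)) (Fin (suc m)) (Fin (suc m))
    bilinear a b cancelʳ cancelˡ = record
      { at = λ x y → res (a * val x + b * val y)
      ; row-injective = λ x e → val-≈-injective (cancelʳ (res-injective e))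
      ; col-injective = λ y e → val-≈-injective (cancelˡ (res-injective e))
      }

    M : ℤ
    M = 1ℤ + + 2 * + suc h

  B₀ C₀ : Latin (Fin (suc m)) (Fin (suc m)) (Fin (suc m))
  B₀ = bilinear (+ 2) -1ℤ
    (λ {x} {y} {y′} → ≈-linear -1ℤ 0ℤ (l₁ (val x) (val y) (val y′) M))
    (λ {x} {x′} {y} → ≈-linear (+ suc h + 1ℤ) (- (val x - val x′)) (l₂ (+ suc h) (val x) (val x′) (val y)))
    where
    l₁ : ∀ x y y′ M → y - y′ ≡ -1ℤ * ((+ 2 * x + -1ℤ * y) - (+ 2 * x + -1ℤ * y′)) + 0ℤ * M
    l₁ = solveℤ-∀
    l₂ : ∀ P x x′ y → x - x′ ≡ (P + 1ℤ) * ((+ 2 * x + -1ℤ * y) - (+ 2 * x′ + -1ℤ * y)) + (- (x - x′)) * (1ℤ + + 2 * P)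
    l₂ = solveℤ-∀
  C₀ = bilinear 1ℤ (- (+ 2))
    (λ {x} {y} {y′} → ≈-linear (- (+ suc h + 1ℤ)) (- (val y - val y′)) (l₁ (+ suc h) (val x) (val y) (val y′)))
    (λ {x} {x′} {y} → ≈-linear 1ℤ 0ℤ (l₂ (val x) (val x′) (val y) M))
    where
    l₁ : ∀ P x y y′ → y - y′ ≡ (- (P + 1ℤ)) * ((1ℤ * x + - (+ 2) * y) - (1ℤ * x + - (+ 2) * y′)) + (- (y - y′)) * (1ℤ + + 2 * P)
    l₁ = solveℤ-∀
    l₂ : ∀ x x′ y M → x - x′ ≡ 1ℤ * ((1ℤ * x + - (+ 2) * y) - (1ℤ * x′ + - (+ 2) * y)) + 0ℤ * M
    l₂ = solveℤ-∀

  abstract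
    Â B̂ Ĉ : Latin (Maybe P) (Maybe P) (Maybe P)
    Â = pullback ι average
    B̂ = pullback ι B₀
    Ĉ = pullback ι C₀

    cell : ∀ {N : Latin (Fin (suc m)) (Fin (suc m)) (Fin (suc m))} {x y z} → at N (res (code x)) (res (code y)) ≡ res (code z) →
      at (pullback ι N) x y ≡ z
    cell {N} {x} {y} {z} e = trans (cong₂ (λ v w → Inverse.from ι (at N v w)) (ι≡ x) (ι≡ y))
      (trans (cong (Inverse.from ι) (trans e (≡.sym (ι≡ z)))) (Inverse.strictlyInverseʳ ι z))

    bilinear≡ : ∀ (a b : ℤ) {x y z} → a * x + b * y ≡ z → res (a * val (res x) + b * val (res y)) ≡ res z
    bilinear≡ a b {x} {y} {z} refl = res-cong (≈-linear₂ a b 0ℤ (lemma a b x y (val (res x)) (val (res y)) M) (val-res x) (val-res y))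
      where
      lemma : ∀ a b x y v w M → a * v + b * w - (a * x + b * y) ≡ a * (v - x) + b * (w - y) + 0ℤ * M
      lemma = solveℤ-∀

    A-idempotent : ∀ x → at Â x x ≡ x
    A-idempotent = pullback-idempotent ι {average} average-idempotent

    B-idempotent : ∀ x → at B̂ x x ≡ x
    B-idempotent x = cell {B₀} {x} {x} (bilinear≡ (+ 2) -1ℤ (lemma (code x)))
      where
      lemma : ∀ x → + 2 * x + -1ℤ * x ≡ x
      lemma = solveℤ-∀

    B-nothing : ∀ {x y} → code y ≡ - code x → at B̂ nothing x ≡ y
    B-nothing {x} {y} e = cell {B₀} {nothing} {x} (bilinear≡ (+ 2) -1ℤ (trans (lemma (code x)) (≡.sym e)))
      where
      lemma : ∀ x → + 2 * 0ℤ + -1ℤ * x ≡ - x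
      lemma = solveℤ-∀

    C-diagonal : ∀ {x y} → code y ≡ - code x → at Ĉ x x ≡ y
    C-diagonal {x} {y} e = cell {C₀} {x} {x} (bilinear≡ 1ℤ (- (+ 2)) (trans (lemma (code x)) (≡.sym e)))
      where
      lemma : ∀ x → 1ℤ * x + - (+ 2) * x ≡ - x
      lemma = solveℤ-∀

    C-nothing : ∀ x → at Ĉ x nothing ≡ x
    C-nothing x = cell {C₀} {x} {nothing} (bilinear≡ 1ℤ (- (+ 2)) (lemma (code x)))
      where
      lemma : ∀ x → 1ℤ * x + - (+ 2) * 0ℤ ≡ x
      lemma = solveℤ-∀

    -- The average vanishes only for y = -x, and there 2x - 0 = 0 - 2y.
    match : ∀ x y → at Â x y ≡ nothing → at B̂ x nothing ≡ at Ĉ nothing y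
    match x y e = cong (Inverse.from ι) (res-cong (≈-linear₂ (+ 2) (- (+ 2)) 0ℤ
      (lemma (val (res (code x))) (val (res (code y))) (val (res 0ℤ)) M)
      sum≈0
      (val-res 0ℤ)))
      where
      zeroAverage : at average (res (code x)) (res (code y)) ≡ res 0ℤ
      zeroAverage = trans (≡.sym (Inverse.strictlyInverseˡ ι _)) (cong (Inverse.to ι) e)
      lemma₂ : ∀ x y v M → (x + y) - 0ℤ ≡ -1ℤ * (+ 2 * v - (x + y)) + + 2 * (v - 0ℤ) + 0ℤ * M
      lemma₂ = solveℤ-∀
      sum≈0 : val (res (code x)) + val (res (code y)) ≈ 0ℤ
      sum≈0 = ≈-linear₂ -1ℤ (+ 2) 0ℤ (lemma₂ (val (res (code x))) (val (res (code y))) (val (at average (res (code x)) (res (code y)))) M)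
        (average-value _ _) (≈-trans (≈-reflexive (cong val zeroAverage)) (val-res 0ℤ))
      lemma : ∀ x y z M → (+ 2 * x + -1ℤ * z) - (1ℤ * z + - (+ 2) * y) ≡ + 2 * ((x + y) - 0ℤ) + (- (+ 2)) * (z - 0ℤ) + 0ℤ * M
      lemma = solveℤ-∀

  module Even = Residue m (+ m) refl

  rank : Fin 2 → ℕ → ℕ
  rank 0F t = t ℕ.+ suc h
  rank 1F t = t

  private
    halfCode : P → ℕ
    halfCode x = rank (side x) (pair x)

    m≡ : suc h ℕ.+ suc h ≡ m
    m≡ = lemma h
      where
      lemma : ∀ h → suc h ℕ.+ suc h ≡ 2 ℕ.+ h ℕ.* 2
      lemma = solve-∀

    halfCode<m : ∀ x → halfCode x ℕ.< m
    halfCode<m x = subst (halfCode x ℕ.<_) m≡ (bound (side x))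
      where
      bound : ∀ b → rank b (pair x) ℕ.< suc h ℕ.+ suc h
      bound 0F = ℕ.+-monoˡ-< (suc h) (s≤s (pair≤ x))
      bound 1F = ℕ.≤-trans (s≤s (pair≤ x)) (ℕ.m≤m+n (suc h) (suc h))

    rank-injective : ∀ b b′ {t t′} → t ℕ.≤ h → t′ ℕ.≤ h → rank b t ≡ rank b′ t′ → t ≡ t′ × b ≡ b′
    rank-injective 0F 0F {t} {t′} _ _ e = ℕ.+-cancelʳ-≡ (suc h) t t′ e , refl
    rank-injective 0F 1F {t} t≤ t′≤ refl = contradiction t′≤ (ℕ.<⇒≱ (ℕ.m≤n+m (suc h) t))
    rank-injective 1F 0F {t} {t′} t≤ t′≤ refl = contradiction t≤ (ℕ.<⇒≱ (ℕ.m≤n+m (suc h) t′))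
    rank-injective 1F 1F _ _ e = e , refl

    halfCode-injective : ∀ {x y} → + halfCode x Even.≈ + halfCode y → x ≡ y
    halfCode-injective {x} {y} e with rank-injective (side x) (side y) (pair≤ x) (pair≤ y) (Even.nat-≈-injective (halfCode<m x) (halfCode<m y) e)
    ... | p , s = pair-side p s

  abstract
    D : Latin P P P
    D = record
      { at = λ x y → from (Even.res (+ halfCode x + + halfCode y))
      ; row-injective = λ x {y} {y′} e → halfCode-injective (Even.≈-linear 1ℤ 0ℤ (l₁ (+ halfCode x) (+ halfCode y) (+ halfCode y′) (+ m))
          (Even.res-injective (↔-from-injective std e)))
      ; col-injective = λ y {x} {x′} e → halfCode-injective (Even.≈-linear 1ℤ 0ℤ (l₂ (+ halfCode y) (+ halfCode x) (+ halfCode x′) (+ m))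
          (Even.res-injective (↔-from-injective std e)))
      }
      where
      l₁ : ∀ x y y′ M → y - y′ ≡ 1ℤ * ((x + y) - (x + y′)) + 0ℤ * M
      l₁ = solveℤ-∀
      l₂ : ∀ y x x′ M → x - x′ ≡ 1ℤ * ((x + y) - (x′ + y)) + 0ℤ * M
      l₂ = solveℤ-∀

    double : ∀ q → suc q ℕ.+ suc q ≡ 2 ℕ.+ (2 ℕ.* q ℕ.+ 0)
    double = solve-∀

    D≡ : ∀ {x y z} → halfCode x ℕ.+ halfCode y ≡ toℕ (to z) → at D x y ≡ z
    D≡ {x} {y} {z} e = trans (cong from (Even.res≡ (Even.≈-reflexive (trans (cong +_ e) (≡.sym (Even.val≡toℕ (to z))))))) (strictlyInverseʳ z)

  open Odd.Construction Â B̂ Ĉ D match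
  open Schemes (λ q b → A-idempotent _) (λ q → B-idempotent _) (λ q → C-diagonal {just (inj₂ (q , 0F))} refl)
    (λ q → D≡ {inj₂ (q , 1F)} {inj₂ (q , 1F)} (trans (double (toℕ q)) (≡.sym (toℕ-gen q 0F))))
    using (scheme)

  private
    -- Index 0 stands for `nothing`, 1 and 2 for the residues 1 and -1 in the first half, 3 and 4
    -- for the same points in the second. `core₁` trades the corner for a cell of B and one of C,
    -- which gives the odd step; `core₂` instead performs the gadget exchange on the core pair.
    core₀ core₁ core₂ : List (Triple (Fin 5))
    core₀ = (1F , 1F , 3F) ∷ (2F , 2F , 4F) ∷ (0F , 0F , 0F) ∷ []
    core₁ = (1F , 1F , 3F) ∷ (2F , 2F , 4F) ∷ (0F , 3F , 2F) ∷ (3F , 0F , 1F) ∷ []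
    core₂ = (2F , 2F , 4F) ∷ (1F , 3F , 1F) ∷ (3F , 1F , 2F) ∷ (4F , 4F , 3F) ∷ (0F , 0F , 0F) ∷ []

    schemes : ∀ e → e ℕ.≤ 2 → Scheme {J = 1} {h = h} L e
    schemes 0 _ = scheme core₀ refl refl
      (cellA (A-idempotent _) ∷ cellA (A-idempotent _) ∷ cellA∞ (A-idempotent _) (B-idempotent _) ∷ [])
    schemes 1 _ = scheme core₁ refl refl
      (cellA (A-idempotent _) ∷ cellA (A-idempotent _) ∷ cellBC (B-nothing {just (inj₁ 0F)} {just (inj₁ 1F)} refl) ∷ cellBC (C-nothing _) ∷ [])
    schemes 2 _ = scheme core₂ refl refl
      (cellA (A-idempotent _) ∷ cellBC (B-idempotent _) ∷ cellBC (C-diagonal {just (inj₁ 0F)} {just (inj₁ 1F)} refl) ∷ cellD (D≡ {inj₁ 1F} {inj₁ 1F} {inj₁ 0F} (≡.sym (toℕ-core 0F))) ∷ cellA∞ (A-idempotent _) (B-idempotent _) ∷ [])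
    schemes (suc (suc (suc _))) (s≤s (s≤s ()))

  omniversal : Σ (LatinSquare (5 ℕ.+ h ℕ.* 4)) Omniversal
  omniversal = Transport.square (Blown↔Fin 5 4 h) L , schemes-omniversal {5} {1} {h} L refl schemes

-- Order 3 modulo 4

Maybe-↔ : {A B : Set} → A ↔ B → Maybe A ↔ Maybe B
Maybe-↔ {A} {B} A↔B = mk↔ₛ′ (Maybe.map to) (Maybe.map from) f∘g g∘f
  where
  open Inverse A↔B
  f∘g : ∀ x → Maybe.map to (Maybe.map from x) ≡ x
  f∘g (just x) = cong just (strictlyInverseˡ x)
  f∘g nothing = refl
  g∘f : ∀ x → Maybe.map from (Maybe.map to x) ≡ x
  g∘f (just x) = cong just (strictlyInverseʳ x)
  g∘f nothing = refl

-- A, B and C are prolongations of (x+y)/2, (x+y)/2 and (x+y)/2 + 1 modulo r = (n−1)/2 along y = x+1, x+2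
-- and x+2, and D is (x+y)/2 − 1.  The fibres are pairs of consecutive residues.
module ThreeModFour (h : ℕ) where
  open import Data.Integer using (_+_; _*_; -_; _-_)
  open Odd {5} {h} using (P)
  open Enumerate 5 h

  r : ℕ
  r = 5 ℕ.+ h ℕ.* 2

  private
    r-odd : ∀ h → + (5 ℕ.+ h ℕ.* 2) ≡ 1ℤ + + 2 * + (2 ℕ.+ h)
    r-odd h = trans (cong +_ (lemma h)) (cong (λ z → 1ℤ + z) (ℤ.pos-* 2 (2 ℕ.+ h)))
      where
      lemma : ∀ h → 5 ℕ.+ h ℕ.* 2 ≡ 1 ℕ.+ 2 ℕ.* (2 ℕ.+ h)
      lemma = solve-∀

  open OddResidue (2 ℕ.+ h) r (r-odd h)

  private
    M : ℤ
    M = 1ℤ + + 2 * + (2 ℕ.+ h)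

    shift-injective : ∀ s {x y} → shift s x ≡ shift s y → x ≡ y
    shift-injective s e = trans (≡.sym (shift-inverse′ s _)) (trans (cong (shift (- s)) e) (shift-inverse′ s _))

    shifted : ℤ → Latin (Fin r) (Fin r) (Fin r)
    shifted s = reindex {f = id} {g = id} {k = shift s} id id (shift-injective s) average

    module A₀ = Prolong average Fin._≟_ (shift 1ℤ) (shift (- 1ℤ)) (shift-inverse 1ℤ) (shift-inverse′ 1ℤ) (average-shift-injective 1ℤ)
    module B₀ = Prolong average Fin._≟_ (shift (+ 2)) (shift (- (+ 2))) (shift-inverse (+ 2)) (shift-inverse′ (+ 2)) (average-shift-injective (+ 2))
    module C₀ = Prolong (shifted 1ℤ) Fin._≟_ (shift (+ 2)) (shift (- (+ 2))) (shift-inverse (+ 2)) (shift-inverse′ (+ 2))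
      (average-shift-injective (+ 2) ∘ shift-injective 1ℤ)

    value : P → ℕ
    value x = toℕ (to x)

    val-value : ∀ x → val (to x) ≡ + value x
    val-value x = val≡toℕ (to x)

    ι : Maybe P ↔ Maybe (Fin r)
    ι = Maybe-↔ std

    average-at : ∀ {x y z} → value x ℕ.+ value y ≡ 2 ℕ.* value z → at average (to x) (to y) ≡ to z
    average-at {x} {y} {z} e = average≡ (≈-reflexive (trans (cong₂ _+_ (val-value x) (val-value y))
      (trans (cong +_ e) (trans (ℤ.pos-* 2 (value z)) (cong (+ 2 *_) (≡.sym (val-value z)))))))

    shift-at : ∀ s {x y} → + value x + s ≡ + value y → shift s (to x) ≡ to y
    shift-at s {x} {y} e = shift≡ (≈-reflexive (trans (cong (_+ s) (val-value x)) (trans e (≡.sym (val-value y)))))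

    -- The gap `suc d` lies strictly between 0 and r, so the cell is off the broken diagonal y = x +
    -- s and keeps its entry under prolongation.
    misses : ∀ s {x y} d → (+ value x + s) - + value y ≡ + suc d → suc d ℕ.< r → to y ≢ shift s (to x)
    misses s {x} {y} d e = shift-miss (+ suc d) (trans (cong₂ (λ a b → (a + s) - b) (val-value x) (val-value y)) e) λ ()

  abstract
    Â B̂ Ĉ : Latin (Maybe P) (Maybe P) (Maybe P)
    Â = pullback ι A₀.prolongation
    B̂ = pullback ι B₀.prolongation
    Ĉ = pullback ι C₀.prolongation

    D : Latin P P P
    D = pullback std (shifted -1ℤ)

    -- Between old points A has `nothing` exactly for y = x + 1. There B lost the average of x and x
    -- + 2, and C lost the average of y - 2 and y plus 1; both equal x + 1.
    match : ∀ x y → at Â x y ≡ nothing → at B̂ x nothing ≡ at Ĉ nothing y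
    match nothing nothing e = refl
    match (just x) (just y) e = on (to y Fin.≟ shift 1ℤ (to x))
      where
      X Y : Fin r
      X = to x
      Y = to y
      lemma₁ : ∀ x y z M → (x + y) - + 2 * z ≡ 1ℤ * (y - (x + + 2)) + (- (+ 2)) * (z - (x + 1ℤ)) + 0ℤ * M
      lemma₁ = solveℤ-∀
      lemma₂ : ∀ y x z M → (x + y) - + 2 * z ≡ 1ℤ * (x - (y + - (+ 2))) + (- (+ 2)) * (z - (y + -1ℤ)) + 0ℤ * M
      lemma₂ = solveℤ-∀
      left : at average X (shift (+ 2) X) ≡ shift 1ℤ X
      left = average≡ {X} {shift (+ 2) X} {shift 1ℤ X}
        (≈-linear₂ 1ℤ (- (+ 2)) 0ℤ (lemma₁ (val X) (val (shift (+ 2) X)) (val (shift 1ℤ X)) M) (val-res (val X + + 2)) (val-res (val X + 1ℤ)))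
      right : at average (shift (- (+ 2)) Y) Y ≡ shift -1ℤ Y
      right = average≡ {shift (- (+ 2)) Y} {Y} {shift -1ℤ Y}
        (≈-linear₂ 1ℤ (- (+ 2)) 0ℤ (lemma₂ (val Y) (val (shift (- (+ 2)) Y)) (val (shift -1ℤ Y)) M) (val-res (val Y + - (+ 2))) (val-res (val Y + -1ℤ)))
      on : Dec (Y ≡ shift 1ℤ X) → at B̂ (just x) nothing ≡ at Ĉ nothing (just y)
      on (yes p) = cong (λ z → just (from z)) (trans left (trans (≡.sym p) (≡.sym (trans (cong (shift 1ℤ) right) (shift-inverse 1ℤ Y)))))
      on (no p) = contradiction (trans (≡.sym (cong (Maybe.map from) (A₀.op-off p))) e) λ ()

    private
      pulled : ∀ {z : Maybe (Fin r)} (x : P) → z ≡ just (to x) → Maybe.map from z ≡ just x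
      pulled x e = trans (cong (Maybe.map from) e) (cong just (strictlyInverseʳ x))

    A-cell : ∀ x y z d → value x ℕ.+ value y ≡ 2 ℕ.* value z → (+ value x + 1ℤ) - + value y ≡ + suc d → suc d ℕ.< r →
      at Â (just x) (just y) ≡ just z
    A-cell x y z d e e′ lt = pulled z (trans (A₀.op-off (misses 1ℤ {x} {y} d e′ lt)) (cong just (average-at {x} {y} {z} e)))

    A-corner : at Â nothing nothing ≡ nothing
    A-corner = refl

    B-corner : at B̂ nothing nothing ≡ nothing
    B-corner = refl

    B-cell : ∀ x y z d → value x ℕ.+ value y ≡ 2 ℕ.* value z → (+ value x + + 2) - + value y ≡ + suc d → suc d ℕ.< r →
      at B̂ (just x) (just y) ≡ just z
    B-cell x y z d e e′ lt = pulled z (trans (B₀.op-off (misses (+ 2) {x} {y} d e′ lt)) (cong just (average-at {x} {y} {z} e)))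

    B-nothing : ∀ x y → + value x + + 2 ≡ + value y → at B̂ (just x) (just y) ≡ nothing
    B-nothing x y e = cong (Maybe.map from) (B₀.op-on (≡.sym (shift-at (+ 2) {x} {y} e)))

    B-row : ∀ x y z → + value y + - (+ 2) ≡ + value x → value x ℕ.+ value y ≡ 2 ℕ.* value z → at B̂ nothing (just y) ≡ just z
    B-row x y z e e′ = pulled z (cong just (trans (cong (λ v → at average v (to y)) (shift-at (- (+ 2)) {y} {x} e)) (average-at {x} {y} {z} e′)))

    C-cell : ∀ x y w z d → value x ℕ.+ value y ≡ 2 ℕ.* value w → + value w + 1ℤ ≡ + value z →
      (+ value x + + 2) - + value y ≡ + suc d → suc d ℕ.< r → at Ĉ (just x) (just y) ≡ just z
    C-cell x y w z d e e″ e′ lt = pulled z (trans (C₀.op-off (misses (+ 2) {x} {y} d e′ lt))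
      (cong just (trans (cong (shift 1ℤ) (average-at {x} {y} {w} e)) (shift-at 1ℤ {w} {z} e″))))

    C-column : ∀ x y w z → + value x + + 2 ≡ + value y → value x ℕ.+ value y ≡ 2 ℕ.* value w → + value w + 1ℤ ≡ + value z →
      at Ĉ (just x) nothing ≡ just z
    C-column x y w z e e′ e″ = pulled z (cong just (trans (cong (shift 1ℤ)
      (trans (cong (at average (to x)) (shift-at (+ 2) {x} {y} e)) (average-at {x} {y} {w} e′))) (shift-at 1ℤ {w} {z} e″)))

    D-cell : ∀ x y w z → value x ℕ.+ value y ≡ 2 ℕ.* value w → + value w + -1ℤ ≡ + value z → at D x y ≡ z
    D-cell x y w z e e′ = trans (cong from (trans (cong (shift -1ℤ) (average-at {x} {y} {w} e)) (shift-at -1ℤ {w} {z} e′))) (strictlyInverseʳ z)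

  private
    twice : ∀ n → n ℕ.+ n ≡ 2 ℕ.* n
    twice = solve-∀

    cancel : ∀ n s → (+ n + s) - + n ≡ s
    cancel n s = lemma (+ n) s
      where
      lemma : ∀ n s → (n + s) - n ≡ s
      lemma = solveℤ-∀

    next : ∀ q → value (inj₂ (q , 0F)) ℕ.+ 1 ≡ value (inj₂ (q , 1F))
    next q = trans (cong (ℕ._+ 1) (toℕ-gen q 0F)) (trans (lemma (toℕ q)) (≡.sym (toℕ-gen q 1F)))
      where
      lemma : ∀ q → 5 ℕ.+ (2 ℕ.* q ℕ.+ 0) ℕ.+ 1 ≡ 5 ℕ.+ (2 ℕ.* q ℕ.+ 1)
      lemma = solve-∀

    previous : ∀ q → + value (inj₂ (q , 1F)) + -1ℤ ≡ + value (inj₂ (q , 0F))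
    previous q = trans (cong (λ n → + n + -1ℤ) (≡.sym (next q))) (lemma (+ value (inj₂ (q , 0F))))
      where
      lemma : ∀ n → (n + 1ℤ) + -1ℤ ≡ n
      lemma = solveℤ-∀

    A-diagonal : ∀ x → at Â (just x) (just x) ≡ just x
    A-diagonal x = A-cell x x x 0 (twice (value x)) (cancel (value x) 1ℤ) (s≤s (s≤s z≤n))

    B-diagonal : ∀ x → at B̂ (just x) (just x) ≡ just x
    B-diagonal x = B-cell x x x 1 (twice (value x)) (cancel (value x) (+ 2)) (s≤s (s≤s (s≤s z≤n)))

    C-diagonal : ∀ x y → + value x + 1ℤ ≡ + value y → at Ĉ (just x) (just x) ≡ just y
    C-diagonal x y e = C-cell x x x y 1 (twice (value x)) e (cancel (value x) (+ 2)) (s≤s (s≤s (s≤s z≤n)))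

    D-diagonal : ∀ x y → + value x + -1ℤ ≡ + value y → at D x x ≡ y
    D-diagonal x y = D-cell x x x y (twice (value x))

  open Odd.Construction Â B̂ Ĉ D match
  open Schemes (λ q b → A-diagonal (inj₂ (q , b))) (λ q → B-diagonal (inj₂ (q , 0F)))
    (λ q → C-diagonal (inj₂ (q , 0F)) (inj₂ (q , 1F)) (cong +_ (next q)))
    (λ q → D-diagonal (inj₂ (q , 1F)) (inj₂ (q , 0F)) (previous q))
    using (scheme)

  private
    Cell₁₁ : Triple (Fin 11) → Set
    Cell₁₁ = Valid L ∘ mapTriple inj₁

    a₀ : Cell₁₁ (1F , 1F , 6F)
    a₀ = cellA (A-diagonal (inj₁ 0F))

    a₁ : Cell₁₁ (2F , 2F , 7F)
    a₁ = cellA (A-diagonal (inj₁ 1F))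

    a₂ : Cell₁₁ (3F , 3F , 8F)
    a₂ = cellA (A-diagonal (inj₁ 2F))

    a₃ : Cell₁₁ (4F , 4F , 9F)
    a₃ = cellA (A-diagonal (inj₁ 3F))

    a₄ : Cell₁₁ (5F , 5F , # 10)
    a₄ = cellA (A-diagonal (inj₁ 4F))

    ∞ : Cell₁₁ (0F , 0F , 0F)
    ∞ = cellA∞ A-corner B-corner

    b₀ : Cell₁₁ (1F , 6F , 1F)
    b₀ = cellBC (B-diagonal (inj₁ 0F))

    b₂ : Cell₁₁ (3F , 8F , 3F)
    b₂ = cellBC (B-diagonal (inj₁ 2F))

    b∞ : Cell₁₁ (0F , 9F , 3F)
    b∞ = cellBC (B-row (inj₁ 1F) (inj₁ 3F) (inj₁ 2F) refl refl)

    c₀ : Cell₁₁ (6F , 1F , 2F)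
    c₀ = cellBC (C-diagonal (inj₁ 0F) (inj₁ 1F) refl)

    c₂ : Cell₁₁ (8F , 3F , 4F)
    c₂ = cellBC (C-diagonal (inj₁ 2F) (inj₁ 3F) refl)

    c∞ : Cell₁₁ (8F , 0F , 5F)
    c∞ = cellBC (C-column (inj₁ 2F) (inj₁ 4F) (inj₁ 3F) (inj₁ 4F) refl refl refl)

    d₀ : Cell₁₁ (7F , 7F , 6F)
    d₀ = cellD (D-diagonal (inj₁ 1F) (inj₁ 0F) refl)

    d₂ : Cell₁₁ (9F , 9F , 8F)
    d₂ = cellD (D-diagonal (inj₁ 3F) (inj₁ 2F) refl)

    -- Index 0 stands for nothing, 1 + x for x next to nothing, and 6 + x for x in the other half.
    core₀ core₁ core₂ core₃ core₄ core₅ : List (Triple (Fin 11))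
    core₀ = (1F , 1F , 6F) ∷ (2F , 2F , 7F) ∷ (3F , 3F , 8F) ∷ (4F , 4F , 9F) ∷ (5F , 5F , # 10) ∷ (0F , 0F , 0F) ∷ []
    core₁ = (1F , 1F , 6F) ∷ (2F , 2F , 7F) ∷ (3F , 3F , 8F) ∷ (4F , 4F , 9F) ∷ (5F , 5F , # 10) ∷ (0F , 9F , 3F) ∷ (8F , 0F , 5F) ∷ []
    core₂ = (1F , 6F , 1F) ∷ (6F , 1F , 2F) ∷ (7F , 7F , 6F) ∷ (2F , 2F , 7F) ∷ (3F , 3F , 8F) ∷ (4F , 4F , 9F) ∷ (5F , 5F , # 10) ∷ (0F , 0F , 0F) ∷ []
    core₃ = (1F , 6F , 1F) ∷ (6F , 1F , 2F) ∷ (7F , 7F , 6F) ∷ (2F , 2F , 7F) ∷ (3F , 3F , 8F) ∷ (4F , 4F , 9F) ∷ (5F , 5F , # 10) ∷ (0F , 9F , 3F) ∷ (8F , 0F , 5F) ∷ []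
    core₄ = (1F , 6F , 1F) ∷ (6F , 1F , 2F) ∷ (7F , 7F , 6F) ∷ (2F , 2F , 7F) ∷ (3F , 8F , 3F) ∷ (8F , 3F , 4F) ∷ (9F , 9F , 8F) ∷ (4F , 4F , 9F) ∷ (5F , 5F , # 10) ∷ (0F , 0F , 0F) ∷ []
    core₅ = (5F , 5F , # 10) ∷ (4F , 4F , 9F) ∷ (1F , 6F , 1F) ∷ (7F , 7F , 6F) ∷ (9F , 2F , 4F) ∷ (2F , 9F , 0F) ∷ (0F , 8F , 2F) ∷ (# 10 , 3F , 5F)
      ∷ (3F , 1F , 7F) ∷ (6F , 0F , 3F) ∷ (8F , # 10 , 8F) ∷ []

    p : Fin 5 → P
    p = inj₁

    schemes : ∀ e → e ℕ.≤ 5 → Scheme {J = 1} {h = h} L e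
    schemes 0 _ = scheme core₀ refl refl (a₀ ∷ a₁ ∷ a₂ ∷ a₃ ∷ a₄ ∷ ∞ ∷ [])
    schemes 1 _ = scheme core₁ refl refl (a₀ ∷ a₁ ∷ a₂ ∷ a₃ ∷ a₄ ∷ b∞ ∷ c∞ ∷ [])
    schemes 2 _ = scheme core₂ refl refl (b₀ ∷ c₀ ∷ d₀ ∷ a₁ ∷ a₂ ∷ a₃ ∷ a₄ ∷ ∞ ∷ [])
    schemes 3 _ = scheme core₃ refl refl (b₀ ∷ c₀ ∷ d₀ ∷ a₁ ∷ a₂ ∷ a₃ ∷ a₄ ∷ b∞ ∷ c∞ ∷ [])
    schemes 4 _ = scheme core₄ refl refl (b₀ ∷ c₀ ∷ d₀ ∷ a₁ ∷ b₂ ∷ c₂ ∷ d₂ ∷ a₃ ∷ a₄ ∷ ∞ ∷ [])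
    -- Up to here the excess comes from the corner exchange and two pair exchanges. The corner
    -- exchange clashes with the second pair (row 8, column 9, symbol 3), so a separate transversal
    -- of the whole core is needed.
    schemes 5 _ = scheme core₅ refl refl (a₄ ∷ a₃ ∷ b₀ ∷ d₀
      ∷ cellBC (C-cell (p 3F) (p 1F) (p 2F) (p 3F) 3 refl refl refl (s≤s (s≤s (s≤s (s≤s (s≤s z≤n))))))
      ∷ cellBC (B-nothing (p 1F) (p 3F) refl)
      ∷ cellBC (B-row (p 0F) (p 2F) (p 1F) refl refl)
      ∷ cellBC (C-cell (p 4F) (p 2F) (p 3F) (p 4F) 3 refl refl refl (s≤s (s≤s (s≤s (s≤s (s≤s z≤n))))))
      ∷ cellA (A-cell (p 2F) (p 0F) (p 1F) 2 refl refl (s≤s (s≤s (s≤s (s≤s z≤n)))))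
      ∷ cellBC (C-column (p 0F) (p 2F) (p 1F) (p 2F) refl refl refl)
      ∷ cellD (D-cell (p 2F) (p 4F) (p 3F) (p 2F) refl refl)
      ∷ [])
    schemes (suc (suc (suc (suc (suc (suc _)))))) (s≤s (s≤s (s≤s (s≤s (s≤s ())))))

  omniversal : Σ (LatinSquare (11 ℕ.+ h ℕ.* 4)) Omniversal
  omniversal = Transport.square (Blown↔Fin 11 4 h) L , schemes-omniversal {11} {1} {h} L refl schemes

-- Switching an intercalate

module Transposition {A : Set} (_≟_ : DecidableEquality A) (a b : A) where

  transpose : A → A
  transpose x with x ≟ a | x ≟ b
  ... | yes _ | _ = b
  ... | no _ | yes _ = a
  ... | no _ | no _ = x

  transpose-left : transpose a ≡ b
  transpose-left with a ≟ a | a ≟ b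
  ... | yes _ | _ = refl
  ... | no ne | _ = contradiction refl ne

  transpose-right : transpose b ≡ a
  transpose-right with b ≟ a | b ≟ b
  ... | yes e | _ = e
  ... | no _ | yes _ = refl
  ... | no _ | no ne = contradiction refl ne

  transpose-other : ∀ {x} → x ≢ a → x ≢ b → transpose x ≡ x
  transpose-other {x} x≢a x≢b with x ≟ a | x ≟ b
  ... | yes e | _ = contradiction e x≢a
  ... | no _ | yes e = contradiction e x≢b
  ... | no _ | no _ = refl

  transpose-involutive : ∀ x → transpose (transpose x) ≡ x
  transpose-involutive x with x ≟ a | x ≟ b
  ... | yes refl | _ = transpose-right
  ... | no _ | yes refl = transpose-left
  ... | no x≢a | no x≢b = transpose-other x≢a x≢b

  transpose-injective : ∀ {x y} → transpose x ≡ transpose y → x ≡ y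
  transpose-injective e = trans (≡.sym (transpose-involutive _)) (trans (cong transpose e) (transpose-involutive _))

-- Exchanging the two symbols of an intercalate amounts to transposing its columns within its two
-- rows, and equally to transposing its rows within its two columns. The first form makes rows
-- injective at once; `op-col` is the second and does the same for columns.
module Switch {R C S : Set} (L : Latin R C S) (_≟ʳ_ : DecidableEquality R) (_≟ᶜ_ : DecidableEquality C) {r₁ r₂ : R} {c₁ c₂ : C}
  (same : at L r₁ c₁ ≡ at L r₂ c₂) (same′ : at L r₁ c₂ ≡ at L r₂ c₁) where

  open Transposition _≟ᶜ_ c₁ c₂ public
  private module ρ = Transposition _≟ʳ_ r₁ r₂

  op : R → C → S
  op r c with r ≟ʳ r₁ | r ≟ʳ r₂
  ... | no _ | no _ = at L r c
  ... | _ | _ = at L r (transpose c)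

  op-off-row : ∀ {r} c → r ≢ r₁ → r ≢ r₂ → op r c ≡ at L r c
  op-off-row {r} c n₁ n₂ with r ≟ʳ r₁ | r ≟ʳ r₂
  ... | yes e | _ = contradiction e n₁
  ... | no _ | yes e = contradiction e n₂
  ... | no _ | no _ = refl

  op-row₁ : ∀ c → op r₁ c ≡ at L r₁ (transpose c)
  op-row₁ c with r₁ ≟ʳ r₁ | r₁ ≟ʳ r₂
  ... | yes _ | _ = refl
  ... | no ne | _ = contradiction refl ne

  op-row₂ : ∀ c → op r₂ c ≡ at L r₂ (transpose c)
  op-row₂ c with r₂ ≟ʳ r₁ | r₂ ≟ʳ r₂
  ... | yes _ | _ = refl
  ... | no _ | yes _ = refl
  ... | no _ | no ne = contradiction refl ne

  op-cases : ∀ r c → op r c ≡ at L r c ⊎ op r c ≡ at L r (transpose c)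
  op-cases r c with r ≟ʳ r₁ | r ≟ʳ r₂
  ... | yes _ | _ = inj₂ refl
  ... | no _ | yes _ = inj₂ refl
  ... | no _ | no _ = inj₁ refl

  op-off-col : ∀ r {c} → c ≢ c₁ → c ≢ c₂ → op r c ≡ at L r c
  op-off-col r {c} n₁ n₂ with op-cases r c
  ... | inj₁ e = e
  ... | inj₂ e = trans e (cong (at L r) (transpose-other n₁ n₂))

  private
    op-col : ∀ r {c} → c ≡ c₁ ⊎ c ≡ c₂ → op r c ≡ at L (ρ.transpose r) c
    op-col r {c} c∈ with r ≟ʳ r₁ | r ≟ʳ r₂
    op-col r (inj₁ refl) | yes refl | _ = trans (cong (at L r) transpose-left) same′
    op-col r (inj₂ refl) | yes refl | _ = trans (cong (at L r) transpose-right) same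
    op-col r (inj₁ refl) | no _ | yes refl = trans (cong (at L r) transpose-left) (≡.sym same)
    op-col r (inj₂ refl) | no _ | yes refl = trans (cong (at L r) transpose-right) (≡.sym same′)
    ... | no _ | no _ = refl

    row-inj : ∀ r {c c′} → op r c ≡ op r c′ → c ≡ c′
    row-inj r e with r ≟ʳ r₁ | r ≟ʳ r₂
    ... | yes _ | _ = transpose-injective (row-injective L r e)
    ... | no _ | yes _ = transpose-injective (row-injective L r e)
    ... | no _ | no _ = row-injective L r e

    col-inj : ∀ c {r r′} → op r c ≡ op r′ c → r ≡ r′
    col-inj c {r} {r′} e with c ≟ᶜ c₁ | c ≟ᶜ c₂
    ... | yes p | _ = ρ.transpose-injective (col-injective L c (trans (≡.sym (op-col r (inj₁ p))) (trans e (op-col r′ (inj₁ p)))))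
    ... | no _ | yes p = ρ.transpose-injective (col-injective L c (trans (≡.sym (op-col r (inj₂ p))) (trans e (op-col r′ (inj₂ p)))))
    ... | no n₁ | no n₂ = col-injective L c (trans (≡.sym (op-off-col r n₁ n₂)) (trans e (op-off-col r′ n₁ n₂)))

  switched : Latin R C S
  switched = record { at = op ; row-injective = row-inj ; col-injective = col-inj }

-- The Klein four-group and its gadgets

flip : Fin 2 → Fin 2
flip 0F = 1F
flip 1F = 0F

flip-flip : ∀ b → flip (flip b) ≡ b
flip-flip 0F = refl
flip-flip 1F = refl

infixl 6 _⊕_
_⊕_ : Fin 4 → Fin 4 → Fin 4
0F ⊕ v = v
1F ⊕ 0F = 1F
1F ⊕ 1F = 0F
1F ⊕ 2F = 3F
1F ⊕ 3F = 2F
2F ⊕ 0F = 2F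
2F ⊕ 1F = 3F
2F ⊕ 2F = 0F
2F ⊕ 3F = 1F
3F ⊕ 0F = 3F
3F ⊕ 1F = 2F
3F ⊕ 2F = 1F
3F ⊕ 3F = 0F

⊕-cancelˡ : ∀ u v v′ → u ⊕ v ≡ u ⊕ v′ → v ≡ v′
⊕-cancelˡ = from-yes (Fin.all? λ u → Fin.all? λ v → Fin.all? λ v′ → (u ⊕ v Fin.≟ u ⊕ v′) →-dec (v Fin.≟ v′))

⊕-cancelʳ : ∀ v u u′ → u ⊕ v ≡ u′ ⊕ v → u ≡ u′
⊕-cancelʳ = from-yes (Fin.all? λ v → Fin.all? λ u → Fin.all? λ u′ → (u ⊕ v Fin.≟ u′ ⊕ v) →-dec (u Fin.≟ u′))

-- A block index 2u + i stands for the element (u , i) of the Klein four-group.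
high odd : Fin 4 → Bool
high 0F = false
high 1F = false
high 2F = true
high 3F = true
odd 0F = false
odd 1F = true
odd 2F = false
odd 3F = true

flipAt : Fin 4 → Fin 2 → Fin 2
flipAt 1F b = flip b
flipAt 0F b = b
flipAt 2F b = b
flipAt 3F b = b

-- Point 2v + b of a fibre lies in block v.  The triples were found by computer search.
Gadget : Set
Gadget = Fin 3 → List (Triple (Fin 8))

-- A transversal of a whole fibre covers every region, so it is the top level of all three families.
full : List (Triple (Fin 8))
full = (4F , 0F , 4F) ∷ (2F , 4F , 7F) ∷ (0F , 2F , 2F) ∷ (6F , 6F , 0F) ∷ (3F , 5F , 6F) ∷ (5F , 1F , 5F) ∷ (1F , 3F , 3F) ∷ (7F , 7F , 1F) ∷ []

lowGadget highGadget oddGadget : Gadget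
lowGadget 0F = (0F , 0F , 0F) ∷ (2F , 2F , 1F) ∷ (1F , 3F , 3F) ∷ (3F , 1F , 2F) ∷ []
lowGadget 1F = (0F , 2F , 2F) ∷ (2F , 4F , 7F) ∷ (4F , 0F , 4F) ∷ (3F , 3F , 0F) ∷ (6F , 5F , 3F) ∷ (1F , 1F , 1F) ∷ []
lowGadget 2F = full
highGadget 0F = (4F , 4F , 0F) ∷ (6F , 5F , 3F) ∷ (5F , 6F , 2F) ∷ (7F , 7F , 1F) ∷ []
highGadget 1F = (4F , 0F , 4F) ∷ (2F , 4F , 7F) ∷ (7F , 7F , 1F) ∷ (5F , 6F , 2F) ∷ (6F , 5F , 3F) ∷ (3F , 3F , 0F) ∷ []
highGadget 2F = full
oddGadget 0F = (7F , 7F , 1F) ∷ (2F , 6F , 5F) ∷ (3F , 3F , 0F) ∷ (6F , 2F , 4F) ∷ []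
oddGadget 1F = (7F , 7F , 1F) ∷ (2F , 0F , 3F) ∷ (6F , 2F , 4F) ∷ (3F , 3F , 0F) ∷ (5F , 6F , 2F) ∷ (1F , 5F , 5F) ∷ []
oddGadget 2F = full

block : ∀ {d} → Fin (4 ℕ.* d) → Fin 4
block {d} = proj₁ ∘ remQuot {4} d

-- In a quotient of order two, equal classes add up to class 0. Hence the missed rows and columns
-- may form either class, and the symbols to be covered are those of class 0: `lowRegion` misses
-- high lines, `highRegion` low ones, `oddRegion` even ones.
lowRegion highRegion oddRegion : ∀ {d} → Region (Fin (4 ℕ.* d))
lowRegion {d} = region (not ∘ high ∘ block {d}) (not ∘ high ∘ block {d}) (not ∘ high ∘ block {d})
highRegion {d} = region (high ∘ block {d}) (high ∘ block {d}) (not ∘ high ∘ block {d})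
oddRegion {d} = region (odd ∘ block {d}) (odd ∘ block {d}) (not ∘ odd ∘ block {d})

lowGadget-good : ∀ j → Good (lowRegion {2}) (lowGadget j)
lowGadget-good 0F = good! (lowRegion {2}) (lowGadget 0F) refl
lowGadget-good 1F = good! (lowRegion {2}) (lowGadget 1F) refl
lowGadget-good 2F = good! (lowRegion {2}) full refl

lowGadget-length : ∀ j → length (lowGadget j) ≡ 4 ℕ.+ 2 ℕ.* toℕ j
lowGadget-length 0F = refl
lowGadget-length 1F = refl
lowGadget-length 2F = refl

highGadget-good : ∀ j → Good (highRegion {2}) (highGadget j)
highGadget-good 0F = good! (highRegion {2}) (highGadget 0F) refl
highGadget-good 1F = good! (highRegion {2}) (highGadget 1F) refl
highGadget-good 2F = good! (highRegion {2}) full refl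

highGadget-length : ∀ j → length (highGadget j) ≡ 4 ℕ.+ 2 ℕ.* toℕ j
highGadget-length 0F = refl
highGadget-length 1F = refl
highGadget-length 2F = refl

oddGadget-good : ∀ j → Good (oddRegion {2}) (oddGadget j)
oddGadget-good 0F = good! (oddRegion {2}) (oddGadget 0F) refl
oddGadget-good 1F = good! (oddRegion {2}) (oddGadget 1F) refl
oddGadget-good 2F = good! (oddRegion {2}) full refl

oddGadget-length : ∀ j → length (oddGadget j) ≡ 4 ℕ.+ 2 ℕ.* toℕ j
oddGadget-length 0F = refl
oddGadget-length 1F = refl
oddGadget-length 2F = refl

-- Order divisible by 4: the blown-up square

module Four (c h : ℕ) where
  F W V : Set
  F = Blown c 2 h
  W = Fin 4 × F
  V = Blown (4 ℕ.* c) 8 h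

  decCore : Fin 4 × Fin c → W
  decCore (u , a) = u , inj₁ a

  decGen : Fin h → Fin 4 × Fin 2 → W
  decGen q (u , b) = u , inj₂ (q , b)

  dec : V → W
  dec (inj₁ k) = decCore (remQuot c k)
  dec (inj₂ (q , k)) = decGen q (remQuot 2 k)

  enc : W → V
  enc (u , inj₁ a) = inj₁ (combine u a)
  enc (u , inj₂ (q , b)) = inj₂ (q , combine u b)

  V↔W : V ↔ W
  V↔W = mk↔ₛ′ dec enc dec∘enc enc∘dec
    where
    dec∘enc : ∀ w → dec (enc w) ≡ w
    dec∘enc (u , inj₁ a) = cong decCore (Fin.remQuot-combine u a)
    dec∘enc (u , inj₂ (q , b)) = cong (decGen q) (Fin.remQuot-combine u b)
    enc∘dec : ∀ v → enc (dec v) ≡ v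
    enc∘dec (inj₁ k) = cong inj₁ (Fin.combine-remQuot {4} c k)
    enc∘dec (inj₂ (q , k)) = cong (λ k → inj₂ (q , k)) (Fin.combine-remQuot {4} 2 k)

  _≟ᶠ_ : DecidableEquality F
  _≟ᶠ_ = Sum.≡-dec Fin._≟_ (≡-dec Fin._≟_ Fin._≟_)

  abstract
    _≟ʷ_ : DecidableEquality W
    _≟ʷ_ = ≡-dec Fin._≟_ _≟ᶠ_

  -- Replace every cell (u , v) of the Klein four-group by a copy of N, twisted by τ and γ, and then switch an
  -- intercalate that respects the quotient (u , i) ↦ u but not the quotient (u , i) ↦ i.
  module Construction (N : Latin F F F) (idem : Idempotent N)
    (bar : F → F) (bar-injective : ∀ {x y} → bar x ≡ bar y → x ≡ y) (bar-gen : ∀ q b → bar (inj₂ (q , b)) ≡ inj₂ (q , flip b))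
    (g g⁻¹ : F → F) (g∘g⁻¹ : ∀ x → g (g⁻¹ x) ≡ x) (g⁻¹∘g : ∀ x → g⁻¹ (g x) ≡ x) (g-gen : ∀ q → g (inj₂ (q , 1F)) ≡ inj₂ (q , 0F))
    (z₀ : Fin c) (z-moved : g⁻¹ (inj₁ z₀) ≢ inj₁ z₀) (z-side : ∀ q → g⁻¹ (inj₁ z₀) ≢ inj₂ (q , 1F))
    (w : F) (w-solves : at N (g⁻¹ (inj₁ z₀)) w ≡ inj₁ z₀) where

    z y : F
    z = inj₁ z₀
    y = g⁻¹ z

    -- Over a point that `bar` moves, this keeps the diagonal cells of blocks (0 , 0) and (1 , 1)
    -- from sharing a symbol.
    τ : Fin 4 → F → F
    τ 1F = bar
    τ 0F = id
    τ 2F = id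
    τ 3F = id

    -- In block (2 , 3) the cell in row x and column g x carries g x, and its mirror image in block
    -- (3 , 2) carries x. That the two twists are inverse also makes the intercalate close up with y
    -- = g⁻¹ z.
    γ : Fin 4 → Fin 4 → F → F
    γ 2F 3F = g
    γ 3F 2F = g⁻¹
    γ _ _ = id

    τ-injective : ∀ u {x x′} → τ u x ≡ τ u x′ → x ≡ x′
    τ-injective 0F e = e
    τ-injective 1F e = bar-injective e
    τ-injective 2F e = e
    τ-injective 3F e = e

    γ-injective : ∀ u v {x x′} → γ u v x ≡ γ u v x′ → x ≡ x′
    γ-injective 0F _ e = e
    γ-injective 1F _ e = e
    γ-injective 2F 0F e = e
    γ-injective 2F 1F e = e
    γ-injective 2F 2F e = e
    γ-injective 2F 3F e = trans (≡.sym (g⁻¹∘g _)) (trans (cong g⁻¹ e) (g⁻¹∘g _))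
    γ-injective 3F 0F e = e
    γ-injective 3F 1F e = e
    γ-injective 3F 2F e = trans (≡.sym (g∘g⁻¹ _)) (trans (cong g e) (g∘g⁻¹ _))
    γ-injective 3F 3F e = e

    blocks : Latin W W W
    blocks = record
      { at = λ (u , x) (v , x′) → u ⊕ v , τ u (at N (γ u v x) x′)
      ; row-injective = λ (u , x) → row-inj u x
      ; col-injective = λ (v , x) → col-inj v x
      }
      where
      row-inj : ∀ u x {c c′ : W} → (u ⊕ proj₁ c , τ u (at N (γ u (proj₁ c) x) (proj₂ c))) ≡ (u ⊕ proj₁ c′ , τ u (at N (γ u (proj₁ c′) x) (proj₂ c′))) → c ≡ c′
      row-inj u x {v , x′} {v′ , x″} e with ,-injective e
      ... | e₁ , e₂ with ⊕-cancelˡ u v v′ e₁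
      ... | refl = cong (v ,_) (row-injective N _ (τ-injective u e₂))
      col-inj : ∀ v x {r r′ : W} → (proj₁ r ⊕ v , τ (proj₁ r) (at N (γ (proj₁ r) v (proj₂ r)) x)) ≡ (proj₁ r′ ⊕ v , τ (proj₁ r′) (at N (γ (proj₁ r′) v (proj₂ r′)) x)) → r ≡ r′
      col-inj v x {u , x′} {u′ , x″} e with ,-injective e
      ... | e₁ , e₂ with ⊕-cancelʳ v u u′ e₁
      ... | refl = cong (u ,_) (γ-injective u v (col-injective N x (τ-injective u e₂)))

    private
      -- The intercalate has the symbols (0 , z) and (1 , z), whose blocks agree under `high` and
      -- differ under `odd`.
      same : at blocks (2F , y) (2F , w) ≡ at blocks (3F , z) (3F , z)
      same = cong (0F ,_) (trans w-solves (≡.sym (idem z)))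

      same′ : at blocks (2F , y) (3F , z) ≡ at blocks (3F , z) (2F , w)
      same′ = cong (1F ,_) (trans (cong (λ x → at N x z) (g∘g⁻¹ z)) (trans (idem z) (≡.sym w-solves)))

    open Switch blocks _≟ʷ_ _≟ʷ_ {2F , y} {3F , z} {2F , w} {3F , z} same same′

    L : Latin V V V
    L = pullback V↔W switched

    -- Excluded are the two blocks twisted by `γ` and block (3 , 3), whose diagonal contains a
    -- switched cell.
    plain : Fin 4 → Fin 4 → Bool
    plain 2F 3F = false
    plain 3F 2F = false
    plain 3F 3F = false
    plain _ _ = true

    private
      block≢ : ∀ {u u′ : Fin 4} {x x′ : F} → u ≢ u′ → (u , x) ≢ (u′ , x′)
      block≢ ne refl = ne refl

      fibre≢ : ∀ {u : Fin 4} {x x′ : F} → x ≢ x′ → (u , x) ≢ (u , x′)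
      fibre≢ ne refl = ne refl

    diagonal : ∀ u v x → plain u v ≡ true → op (u , x) (v , x) ≡ (u ⊕ v , τ u x)
    diagonal 0F v x _ = trans (op-off-row _ (block≢ λ ()) (block≢ λ ())) (cong (v ,_) (idem x))
    diagonal 1F v x _ = trans (op-off-row _ (block≢ λ ()) (block≢ λ ())) (cong (λ s → 1F ⊕ v , bar s) (idem x))
    diagonal 2F 0F x _ = trans (op-off-col (2F , x) (block≢ λ ()) (block≢ λ ())) (cong (2F ,_) (idem x))
    diagonal 2F 1F x _ = trans (op-off-col (2F , x) (block≢ λ ()) (block≢ λ ())) (cong (3F ,_) (idem x))
    diagonal 2F 2F x _ with x ≟ᶠ y
    ... | no x≢y = trans (op-off-row _ (fibre≢ x≢y) (block≢ λ ())) (cong (0F ,_) (idem x))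
    -- Row y of block (2 , 2) is switched in column w, which is not the diagonal cell: y = w would
    -- give y = z by idempotence, but z is moved.
    ... | yes refl = trans (op-off-col (2F , y) (fibre≢ y≢w) (block≢ λ ())) (cong (0F ,_) (idem y))
      where
      y≢w : y ≢ w
      y≢w e = z-moved (trans (≡.sym (idem y)) (trans (cong (at N y) e) w-solves))
    diagonal 2F 3F x ()
    diagonal 3F 2F x ()
    diagonal 3F 3F x ()
    diagonal 3F 0F x _ = trans (op-off-col (3F , x) (block≢ λ ()) (block≢ λ ())) (cong (3F ,_) (idem x))
    diagonal 3F 1F x _ = trans (op-off-col (3F , x) (block≢ λ ()) (block≢ λ ())) (cong (2F ,_) (idem x))

    diagonal₃₃ : ∀ x → x ≢ z → op (3F , x) (3F , x) ≡ (0F , x)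
    diagonal₃₃ x x≢z = trans (op-off-row _ (block≢ λ ()) (fibre≢ x≢z)) (cong (0F ,_) (idem x))

    -- Odd row, odd column and odd symbol: this is the cell that violates the quotient by `odd` and
    -- is used by every odd core.
    switched₃₃ : op (3F , z) (3F , z) ≡ (1F , z)
    switched₃₃ = trans (op-row₂ (3F , z)) (trans (cong (at blocks (3F , z)) transpose-right) (cong (1F ,_) w-solves))

    cell₂₃ : ∀ {x x′} → g x ≡ x′ → x ≢ y → op (2F , x) (3F , x′) ≡ (1F , x′)
    cell₂₃ {x} refl x≢y = trans (op-off-row _ (fibre≢ x≢y) (block≢ λ ())) (cong (1F ,_) (idem (g x)))

    cell₃₂ : ∀ {x x′} → g x ≡ x′ → x′ ≢ z → op (3F , x′) (2F , x) ≡ (1F , x)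
    cell₃₂ {x} refl gx≢z = trans (op-off-row _ (block≢ λ ()) (fibre≢ gx≢z))
      (cong (1F ,_) (trans (cong (λ s → at N s x) (g⁻¹∘g x)) (idem x)))

    private
      high-transpose : ∀ v → high (proj₁ (transpose v)) ≡ high (proj₁ v)
      high-transpose v with v ≟ʷ (2F , w) | v ≟ʷ (3F , z)
      ... | yes refl | _ = refl
      ... | no _ | yes refl = refl
      ... | no _ | no _ = refl

      high-high : ∀ u v → high u ≡ true → high v ≡ true → high (u ⊕ v) ≡ false
      high-high = from-yes (Fin.all? λ u → Fin.all? λ v → (high u Bool.≟ true) →-dec ((high v Bool.≟ true) →-dec (high (u ⊕ v) Bool.≟ false)))

      low-low : ∀ u v → high u ≡ false → high v ≡ false → high (u ⊕ v) ≡ false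
      low-low = from-yes (Fin.all? λ u → Fin.all? λ v → (high u Bool.≟ false) →-dec ((high v Bool.≟ false) →-dec (high (u ⊕ v) Bool.≟ false)))

      even-even : ∀ u v → odd u ≡ false → odd v ≡ false → odd (u ⊕ v) ≡ false
      even-even = from-yes (Fin.all? λ u → Fin.all? λ v → (odd u Bool.≟ false) →-dec ((odd v Bool.≟ false) →-dec (odd (u ⊕ v) Bool.≟ false)))

    -- The switch transposes columns of blocks 2 and 3 only, and both are high.
    block-high : ∀ r c → high (proj₁ r) ≡ true → high (proj₁ c) ≡ true → high (proj₁ (op r c)) ≡ false
    block-high r c er ec with op-cases r c
    ... | inj₁ e = trans (cong (high ∘ proj₁) e) (high-high (proj₁ r) (proj₁ c) er ec)
    ... | inj₂ e = trans (cong (high ∘ proj₁) e) (high-high (proj₁ r) (proj₁ (transpose c)) er (trans (high-transpose c) ec))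

    block-low : ∀ r c → high (proj₁ r) ≡ false → high (proj₁ c) ≡ false → high (proj₁ (op r c)) ≡ false
    block-low r c er ec = trans (cong (high ∘ proj₁) (op-off-row {r} c (low≢ r er refl) (low≢ r er refl))) (low-low (proj₁ r) (proj₁ c) er ec)
      where
      low≢ : ∀ (r : W) {r′ : W} → high (proj₁ r) ≡ false → high (proj₁ r′) ≡ true → r ≢ r′
      low≢ r e e′ refl = contradiction (trans (≡.sym e) e′) λ ()

    -- Of the four switched cells only the one in row (2 , y) and column (2 , w) has an even row and
    -- an even column.
    block-even : ∀ r c → odd (proj₁ r) ≡ false → odd (proj₁ c) ≡ false → odd (proj₁ (op r c)) ≡ false ⊎ op r c ≡ (1F , z)
    block-even r c er ec = go (op-cases r c) (c ≟ʷ (2F , w)) (c ≟ʷ (3F , z)) (r ≟ʷ (2F , y))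
      where
      Goal : Set
      Goal = odd (proj₁ (op r c)) ≡ false ⊎ op r c ≡ (1F , z)
      usual : op r c ≡ at blocks r c → Goal
      usual e = inj₁ (trans (cong (odd ∘ proj₁) e) (even-even (proj₁ r) (proj₁ c) er ec))
      even≢ : r ≢ (3F , z)
      even≢ e = contradiction (trans (≡.sym er) (cong (odd ∘ proj₁) e)) λ ()
      go : op r c ≡ at blocks r c ⊎ op r c ≡ at blocks r (transpose c) → Dec (c ≡ (2F , w)) → Dec (c ≡ (3F , z)) → Dec (r ≡ (2F , y)) → Goal
      go (inj₁ e) _ _ _ = usual e
      go (inj₂ _) _ _ (no r≢) = usual (op-off-row c r≢ even≢)
      go (inj₂ _) _ (yes e′) _ = contradiction (trans (≡.sym ec) (cong (odd ∘ proj₁) e′)) λ ()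
      go (inj₂ _) (no n₁) (no n₂) _ = usual (op-off-col r n₁ n₂)
      go (inj₂ e) (yes c≡) (no _) (yes r≡) = inj₂ (trans e (trans (cong₂ (λ r c → at blocks r (transpose c)) r≡ c≡)
        (trans (cong (at blocks (2F , y)) transpose-left) (trans same′ (cong (1F ,_) w-solves)))))

    Cellᵍ : Fin h → Triple (Fin 8) → Set
    Cellᵍ q = Valid L ∘ mapTriple (λ k → inj₂ (q , k))

    private
      τ-gen : ∀ u q b → τ u (inj₂ (q , b)) ≡ inj₂ (q , flipAt u b)
      τ-gen 0F q b = refl
      τ-gen 1F q b = bar-gen q b
      τ-gen 2F q b = refl
      τ-gen 3F q b = refl

      at-gen : ∀ {q u v b b′ s} → op (u , inj₂ (q , b)) (v , inj₂ (q , b′)) ≡ s →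
        at L (inj₂ (q , combine u b)) (inj₂ (q , combine v b′)) ≡ enc s
      at-gen {q} {u} {v} {b} {b′} e = cong enc (trans (cong₂ op (cong (decGen q) (Fin.remQuot-combine u b)) (cong (decGen q) (Fin.remQuot-combine v b′))) e)

    diagonalᵍ : ∀ {q} u v b → {Data.Bool.T (plain u v)} → Cellᵍ q (combine u b , combine v b , combine (u ⊕ v) (flipAt u b))
    diagonalᵍ {q} u v b {p} = at-gen (trans (diagonal u v (inj₂ (q , b)) (Equivalence.to Bool.T-≡ p)) (cong (u ⊕ v ,_) (τ-gen u q b)))

    diagonal₃₃ᵍ : ∀ {q} b → Cellᵍ q (combine {4} 3F b , combine {4} 3F b , combine {4} 0F b)
    diagonal₃₃ᵍ {q} b = at-gen (diagonal₃₃ (inj₂ (q , b)) λ ())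

    cell₂₃ᵍ : ∀ {q} → Cellᵍ q (5F , 6F , 2F)
    cell₂₃ᵍ {q} = at-gen {q} {2F} {3F} {1F} {0F} (cell₂₃ (g-gen q) (z-side q ∘ ≡.sym))

    cell₃₂ᵍ : ∀ {q} → Cellᵍ q (6F , 5F , 3F)
    cell₃₂ᵍ {q} = at-gen {q} {3F} {2F} {0F} {1F} (cell₃₂ (g-gen q) λ ())

    private
      δ = diagonalᵍ

      full-valid : ∀ q → All (Cellᵍ q) full
      full-valid q = δ 2F 0F 0F ∷ δ 1F 2F 0F ∷ δ 0F 1F 0F ∷ diagonal₃₃ᵍ 0F ∷ δ 1F 2F 1F ∷ δ 2F 0F 1F ∷ δ 0F 1F 1F ∷ diagonal₃₃ᵍ 1F ∷ []

      lowGadget-valid : ∀ j q → All (Cellᵍ q) (lowGadget j)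
      lowGadget-valid 0F q = δ 0F 0F 0F ∷ δ 1F 1F 0F ∷ δ 0F 1F 1F ∷ δ 1F 0F 1F ∷ []
      lowGadget-valid 1F q = δ 0F 1F 0F ∷ δ 1F 2F 0F ∷ δ 2F 0F 0F ∷ δ 1F 1F 1F ∷ cell₃₂ᵍ ∷ δ 0F 0F 1F ∷ []
      lowGadget-valid 2F = full-valid

      highGadget-valid : ∀ j q → All (Cellᵍ q) (highGadget j)
      highGadget-valid 0F q = δ 2F 2F 0F ∷ cell₃₂ᵍ ∷ cell₂₃ᵍ ∷ diagonal₃₃ᵍ 1F ∷ []
      highGadget-valid 1F q = δ 2F 0F 0F ∷ δ 1F 2F 0F ∷ diagonal₃₃ᵍ 1F ∷ cell₂₃ᵍ ∷ cell₃₂ᵍ ∷ δ 1F 1F 1F ∷ []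
      highGadget-valid 2F = full-valid

      oddGadget-valid : ∀ j q → All (Cellᵍ q) (oddGadget j)
      oddGadget-valid 0F q = diagonal₃₃ᵍ 1F ∷ δ 1F 3F 0F ∷ δ 1F 1F 1F ∷ δ 3F 1F 0F ∷ []
      oddGadget-valid 1F q = diagonal₃₃ᵍ 1F ∷ δ 1F 0F 0F ∷ δ 3F 1F 0F ∷ δ 1F 1F 1F ∷ cell₂₃ᵍ ∷ δ 0F 2F 1F ∷ []
      oddGadget-valid 2F = full-valid

    -- The switch brings the symbol z of block 1 into the missed cells.
    oddRegion⁺ : Region (Fin (4 ℕ.* c))
    oddRegion⁺ = region (odd ∘ block {c}) (odd ∘ block {c}) (λ k → not (odd (block {c} k)) ∨ ⌊ k Fin.≟ combine {4} 1F z₀ ⌋)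

    open Assemble {4 ℕ.* c} {8} {h} using (join)

    private
      on-V : (f : Fin 4 → Bool) (v : V) → [ f ∘ block {c} , f ∘ block {2} ∘ proj₂ ]′ v ≡ f (proj₁ (dec v))
      on-V f (inj₁ k) = refl
      on-V f (inj₂ (q , k)) = refl

      dec-at : ∀ v v′ → dec (at L v v′) ≡ op (dec v) (dec v′)
      dec-at v v′ = Inverse.strictlyInverseˡ V↔W (op (dec v) (dec v′))

      symbol-high : ∀ v v′ → high (proj₁ (op (dec v) (dec v′))) ≡ false → [ not ∘ high ∘ block {c} , not ∘ high ∘ block {2} ∘ proj₂ ]′ (at L v v′) ≡ true
      symbol-high v v′ e = trans (on-V (not ∘ high) (at L v v′)) (trans (cong (not ∘ high ∘ proj₁) (dec-at v v′)) (cong not e))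

      not-false : ∀ {b} → not b ≡ false → b ≡ true
      not-false {true} _ = refl

    low-blocked : Blocked L (join (lowRegion {c}) (lowRegion {2}))
    low-blocked v v′ er ec = symbol-high v v′ (block-high (dec v) (dec v′)
      (not-false (trans (≡.sym (on-V (not ∘ high) v)) er)) (not-false (trans (≡.sym (on-V (not ∘ high) v′)) ec)))

    high-blocked : Blocked L (join (highRegion {c}) (highRegion {2}))
    high-blocked v v′ er ec = symbol-high v v′ (block-low (dec v) (dec v′)
      (trans (≡.sym (on-V high v)) er) (trans (≡.sym (on-V high v′)) ec))

    odd-blocked : Blocked L (join oddRegion⁺ (oddRegion {2}))
    odd-blocked v v′ er ec with block-even (dec v) (dec v′) (trans (≡.sym (on-V odd v)) er) (trans (≡.sym (on-V odd v′)) ec)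
    ... | inj₁ e = weaken (at L v v′) (trans (cong (odd ∘ proj₁) (dec-at v v′)) e)
      where
      weaken : ∀ s → odd (proj₁ (dec s)) ≡ false → syms (join oddRegion⁺ (oddRegion {2})) s ≡ true
      weaken (inj₁ k) e = cong (λ b → not b ∨ ⌊ k Fin.≟ combine {4} 1F z₀ ⌋) e
      weaken (inj₂ (q , k)) e = cong not e
    ... | inj₂ e = trans (cong (syms (join oddRegion⁺ (oddRegion {2})) ∘ enc) e)
      (trans (cong (not (odd (block {c} (combine {4} 1F z₀))) ∨_) (self (combine {4} 1F z₀))) (Bool.∨-zeroʳ _))
      where
      self : ∀ {n} (k : Fin n) → ⌊ k Fin.≟ k ⌋ ≡ true
      self k with k Fin.≟ k
      ... | yes _ = refl
      ... | no ne = contradiction refl ne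

    Cellᶜ : Triple (Fin (4 ℕ.* c)) → Set
    Cellᶜ = Valid L ∘ mapTriple inj₁

    at-core : ∀ {u v a b s} → op (u , inj₁ a) (v , inj₁ b) ≡ s → at L (inj₁ (combine u a)) (inj₁ (combine v b)) ≡ enc s
    at-core {u} {v} {a} {b} e = cong enc (trans (cong₂ op (cong decCore (Fin.remQuot-combine u a)) (cong decCore (Fin.remQuot-combine v b))) e)

    private
      gadget-scheme : ∀ {e} {coreRegion : Region (Fin (4 ℕ.* c))} {genRegion : Region (Fin 8)} {gadget : Gadget}
        (good : ∀ j → Good genRegion (gadget j)) → (∀ j → length (gadget j) ≡ 4 ℕ.+ 2 ℕ.* toℕ j) →
        (∀ j q → All (Cellᵍ q) (gadget j)) → Blocked L (join coreRegion genRegion) →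
        (core : List (Triple (Fin (4 ℕ.* c)))) → length core ≡ ⌈ 4 ℕ.* c /2⌉ ℕ.+ e → does (good? coreRegion core) ≡ true → All Cellᶜ core → Scheme {J = 2} {h = h} L e
      gadget-scheme {coreRegion = coreRegion} {genRegion} {gadget} good len valid blk core len′ good′ valid′ = record
        { coreRegion = coreRegion
        ; genRegion = genRegion
        ; core = core
        ; gadget = gadget
        ; core-length = len′
        ; gadget-length = len
        ; core-good = good! coreRegion core good′
        ; gadget-good = good
        ; core-valid = valid′
        ; gadget-valid = valid
        ; blocked = blk
        }

    lowScheme : ∀ {e} core → length core ≡ ⌈ 4 ℕ.* c /2⌉ ℕ.+ e → does (good? (lowRegion {c}) core) ≡ true → All Cellᶜ core → Scheme {J = 2} {h = h} L e
    lowScheme core len ok = gadget-scheme {coreRegion = lowRegion {c}} {lowRegion {2}} {lowGadget} lowGadget-good lowGadget-length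
      lowGadget-valid low-blocked core len ok

    highScheme : ∀ {e} core → length core ≡ ⌈ 4 ℕ.* c /2⌉ ℕ.+ e → does (good? (highRegion {c}) core) ≡ true → All Cellᶜ core → Scheme {J = 2} {h = h} L e
    highScheme core len ok = gadget-scheme {coreRegion = highRegion {c}} {highRegion {2}} {highGadget} highGadget-good highGadget-length
      highGadget-valid high-blocked core len ok

    oddScheme : ∀ {e} core → length core ≡ ⌈ 4 ℕ.* c /2⌉ ℕ.+ e → does (good? (oddRegion⁺) core) ≡ true → All Cellᶜ core → Scheme {J = 2} {h = h} L e
    oddScheme core len ok = gadget-scheme {coreRegion = oddRegion⁺} {oddRegion {2}} {oddGadget} oddGadget-good oddGadget-length
      oddGadget-valid odd-blocked core len ok

-- Orders 4 and 0 modulo 8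

row-onto : ∀ {A : Set} {n} → A ↔ Fin n → (N : Latin A A A) → ∀ y z → ∃ λ w → at N y w ≡ z
row-onto A↔ N y z with injective⇒onto (λ i → to (at N y (from i))) (λ e → ↔-from-injective A↔ (row-injective N y (↔-to-injective A↔ e))) (to z)
  where open Inverse A↔
... | i , e = Inverse.from A↔ i , ↔-to-injective A↔ e

odd-order : ∀ h → + (1 ℕ.+ h ℕ.* 2) ≡ 1ℤ ℤ.+ + 2 ℤ.* + h
odd-order h = trans (cong +_ (cong suc (ℕ.*-comm h 2))) (cong (λ z → 1ℤ ℤ.+ z) (ℤ.pos-* 2 h))

-- Each block has a single core point, so `g` can move z only into a fibre and `h` must be positive.
-- The order left out is 4.
module FourModEight (h′ : ℕ) where

  h : ℕ
  h = suc h′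

  open Four 1 h

  private
    module O = OddResidue h (1 ℕ.+ h ℕ.* 2) (odd-order h)

  abstract
    N : Latin F F F
    N = pullback (Blown↔Fin 1 2 h) O.average

    N-idempotent : Idempotent N
    N-idempotent = pullback-idempotent (Blown↔Fin 1 2 h) {O.average} O.average-idempotent

  bar : F → F
  bar (inj₁ a) = inj₁ a
  bar (inj₂ (q , b)) = inj₂ (q , flip b)

  -- As g⁻¹ z ≠ z lies in a fibre, the switch changes the cell (z , z) of block (3 , 3) but not that of block
  -- (2 , 2); this gives the lower right quarter a transversal although its subsquares have odd order.
  g g⁻¹ : F → F
  g (inj₁ 0F) = inj₂ (0F , 1F)
  g (inj₂ (0F , 0F)) = inj₁ 0F
  g (inj₂ (0F , 1F)) = inj₂ (0F , 0F)
  g (inj₂ (suc q , b)) = inj₂ (suc q , flip b)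
  g⁻¹ (inj₁ 0F) = inj₂ (0F , 0F)
  g⁻¹ (inj₂ (0F , 0F)) = inj₂ (0F , 1F)
  g⁻¹ (inj₂ (0F , 1F)) = inj₁ 0F
  g⁻¹ (inj₂ (suc q , b)) = inj₂ (suc q , flip b)

  private
    bar-bar : ∀ x → bar (bar x) ≡ x
    bar-bar (inj₁ a) = refl
    bar-bar (inj₂ (q , b)) = cong (λ b → inj₂ (q , b)) (flip-flip b)

    g∘g⁻¹ : ∀ x → g (g⁻¹ x) ≡ x
    g∘g⁻¹ (inj₁ 0F) = refl
    g∘g⁻¹ (inj₂ (0F , 0F)) = refl
    g∘g⁻¹ (inj₂ (0F , 1F)) = refl
    g∘g⁻¹ (inj₂ (suc q , b)) = cong (λ b → inj₂ (suc q , b)) (flip-flip b)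

    g⁻¹∘g : ∀ x → g⁻¹ (g x) ≡ x
    g⁻¹∘g (inj₁ 0F) = refl
    g⁻¹∘g (inj₂ (0F , 0F)) = refl
    g⁻¹∘g (inj₂ (0F , 1F)) = refl
    g⁻¹∘g (inj₂ (suc q , b)) = cong (λ b → inj₂ (suc q , b)) (flip-flip b)

    g-gen : ∀ q → g (inj₂ (q , 1F)) ≡ inj₂ (q , 0F)
    g-gen 0F = refl
    g-gen (suc q) = refl

  abstract
    w : ∃ λ w → at N (inj₂ (0F , 0F)) w ≡ inj₁ 0F
    w = row-onto (Blown↔Fin 1 2 h) N (inj₂ (0F , 0F)) (inj₁ 0F)

  open Construction N N-idempotent bar (λ e → trans (≡.sym (bar-bar _)) (trans (cong bar e) (bar-bar _))) (λ _ _ → refl)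
    g g⁻¹ g∘g⁻¹ g⁻¹∘g g-gen 0F (λ ()) (λ _ ()) (proj₁ w) (proj₂ w)

  private
    δ : ∀ u v → plain u v ≡ true → Cellᶜ (Fin.combine {4} {1} u 0F , Fin.combine {4} {1} v 0F , Fin.combine {4} {1} (u ⊕ v) 0F)
    δ 0F v p = at-core {0F} {v} {0F} {0F} (diagonal 0F v z p)
    δ 1F v p = at-core {1F} {v} {0F} {0F} (diagonal 1F v z p)
    δ 2F v p = at-core {2F} {v} {0F} {0F} (diagonal 2F v z p)
    δ 3F v p = at-core {3F} {v} {0F} {0F} (diagonal 3F v z p)

    ε : Cellᶜ (3F , 3F , 1F)
    ε = at-core {3F} {3F} {0F} {0F} switched₃₃

    schemes : ∀ e → e ℕ.≤ 2 → Scheme {J = 2} {h = h} L e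
    schemes 0 _ = highScheme ((2F , 2F , 0F) ∷ (3F , 3F , 1F) ∷ []) refl refl (δ 2F 2F refl ∷ ε ∷ [])
    -- As n/2 is even, the number of missed rows has the parity of the excess of the core, so an odd
    -- excess calls for the quotient by `odd`.
    schemes 1 _ = oddScheme ((1F , 1F , 0F) ∷ (3F , 3F , 1F) ∷ (2F , 0F , 2F) ∷ []) refl refl (δ 1F 1F refl ∷ ε ∷ δ 2F 0F refl ∷ [])
    schemes 2 _ = highScheme ((0F , 1F , 1F) ∷ (1F , 3F , 2F) ∷ (3F , 0F , 3F) ∷ (2F , 2F , 0F) ∷ []) refl refl
      (δ 0F 1F refl ∷ δ 1F 3F refl ∷ δ 3F 0F refl ∷ δ 2F 2F refl ∷ [])
    schemes (suc (suc (suc _))) (s≤s (s≤s ()))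

  omniversal : Σ (LatinSquare (4 ℕ.+ h ℕ.* 8)) Omniversal
  omniversal = Transport.square (Blown↔Fin 4 8 h) L , schemes-omniversal {4} {2} {h} L refl schemes

-- An idempotent square of even order is obtained by prolonging the average along y = x + 1, which
-- avoids the main diagonal once k ≥ 3. For h = 0 it would have order 2, where none exists.
module ZeroModEight (h′ : ℕ) where
  open import Data.Integer using (_+_; _-_)

  h k : ℕ
  h = suc h′
  k = 1 ℕ.+ h ℕ.* 2

  open Four 2 h

  private
    module O = OddResidue h k (odd-order h)

    module E = Prolong O.average Fin._≟_ (O.shift 1ℤ) (O.shift (ℤ.- 1ℤ)) (O.shift-inverse 1ℤ) (O.shift-inverse′ 1ℤ) (O.average-shift-injective 1ℤ)

    F↔Maybe : F ↔ Maybe (Fin k)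
    F↔Maybe = ↔-trans (Blown↔Fin 2 2 h) (↔-sym (Maybe↔Fin ↔-refl))

    E-idempotent : Idempotent E.prolongation
    E-idempotent nothing = refl
    E-idempotent (just x) = trans (E.op-off (O.shift-miss {1ℤ} {x} {x} 1ℤ (lemma (O.val x)) (λ ()) (s≤s (s≤s z≤n)))) (cong just (O.average-idempotent x))
      where
      lemma : ∀ x → (x + 1ℤ) - x ≡ 1ℤ
      lemma = solveℤ-∀

  abstract
    N : Latin F F F
    N = pullback F↔Maybe E.prolongation

    N-idempotent : Idempotent N
    N-idempotent = pullback-idempotent F↔Maybe {E.prolongation} E-idempotent

    w : ∃ λ w → at N (inj₁ 1F) w ≡ inj₁ 0F
    w = row-onto (Blown↔Fin 2 2 h) N (inj₁ 1F) (inj₁ 0F)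

  bar : F → F
  bar (inj₁ a) = inj₁ (flip a)
  bar (inj₂ (q , b)) = inj₂ (q , flip b)

  private
    bar-bar : ∀ x → bar (bar x) ≡ x
    bar-bar (inj₁ a) = cong inj₁ (flip-flip a)
    bar-bar (inj₂ (q , b)) = cong (λ b → inj₂ (q , b)) (flip-flip b)

  open Construction N N-idempotent bar (λ e → trans (≡.sym (bar-bar _)) (trans (cong bar e) (bar-bar _))) (λ _ _ → refl)
    bar bar bar-bar bar-bar (λ _ → refl) 0F (λ ()) (λ _ ()) (proj₁ w) (proj₂ w)

  private
    δ : ∀ u v a → plain u v ≡ true → Cellᶜ (Fin.combine {4} {2} u a , Fin.combine {4} {2} v a , Fin.combine {4} {2} (u ⊕ v) (flipAt u a))
    δ 0F v a p = at-core {0F} {v} {a} {a} (diagonal 0F v (inj₁ a) p)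
    δ 1F v a p = at-core {1F} {v} {a} {a} (diagonal 1F v (inj₁ a) p)
    δ 2F v a p = at-core {2F} {v} {a} {a} (diagonal 2F v (inj₁ a) p)
    δ 3F v a p = at-core {3F} {v} {a} {a} (diagonal 3F v (inj₁ a) p)

    ε : Cellᶜ (6F , 6F , 2F)
    ε = at-core {3F} {3F} {0F} {0F} switched₃₃

    ζ : Cellᶜ (4F , 7F , 3F)
    ζ = at-core {2F} {3F} {0F} {1F} (cell₂₃ {inj₁ 0F} refl λ ())

    core₀ core₁ core₂ core₃ core₄ : List (Triple (Fin 8))
    core₀ = (0F , 0F , 0F) ∷ (2F , 2F , 1F) ∷ (1F , 3F , 3F) ∷ (3F , 1F , 2F) ∷ []
    core₁ = (2F , 2F , 1F) ∷ (6F , 6F , 2F) ∷ (7F , 3F , 5F) ∷ (3F , 7F , 4F) ∷ (4F , 4F , 0F) ∷ []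
    core₂ = (0F , 0F , 0F) ∷ (2F , 2F , 1F) ∷ (1F , 5F , 5F) ∷ (5F , 3F , 7F) ∷ (3F , 1F , 2F) ∷ (4F , 7F , 3F) ∷ []
    core₃ = (2F , 2F , 1F) ∷ (6F , 6F , 2F) ∷ (7F , 1F , 7F) ∷ (1F , 5F , 5F) ∷ (3F , 3F , 0F) ∷ (4F , 7F , 3F) ∷ (0F , 4F , 4F) ∷ []
    core₄ = (0F , 2F , 2F) ∷ (6F , 0F , 6F) ∷ (3F , 7F , 4F) ∷ (4F , 4F , 0F) ∷ (2F , 6F , 5F) ∷ (7F , 1F , 7F) ∷ (1F , 3F , 3F) ∷ (5F , 5F , 1F) ∷ []

    schemes : ∀ e → e ℕ.≤ 4 → Scheme {J = 2} {h = h} L e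
    -- The blocks now have even order and the low quarter, which the switch does not touch, has a
    -- transversal; even excesses use no switched cell.
    schemes 0 _ = lowScheme core₀ refl refl (δ 0F 0F 0F refl ∷ δ 1F 1F 0F refl ∷ δ 0F 1F 1F refl ∷ δ 1F 0F 1F refl ∷ [])
    schemes 1 _ = oddScheme core₁ refl refl (δ 1F 1F 0F refl ∷ ε ∷ δ 3F 1F 1F refl ∷ δ 1F 3F 1F refl ∷ δ 2F 2F 0F refl ∷ [])
    schemes 2 _ = lowScheme core₂ refl refl (δ 0F 0F 0F refl ∷ δ 1F 1F 0F refl ∷ δ 0F 2F 1F refl ∷ δ 2F 1F 1F refl ∷ δ 1F 0F 1F refl ∷ ζ ∷ [])
    schemes 3 _ = oddScheme core₃ refl refl (δ 1F 1F 0F refl ∷ ε ∷ δ 3F 0F 1F refl ∷ δ 0F 2F 1F refl ∷ δ 1F 1F 1F refl ∷ ζ ∷ δ 0F 2F 0F refl ∷ [])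
    schemes 4 _ = lowScheme core₄ refl refl (δ 0F 1F 0F refl ∷ δ 3F 0F 0F refl ∷ δ 1F 3F 1F refl ∷ δ 2F 2F 0F refl ∷ δ 1F 3F 0F refl ∷ δ 3F 0F 1F refl
      ∷ δ 0F 1F 1F refl ∷ δ 2F 2F 1F refl ∷ [])
    schemes (suc (suc (suc (suc (suc _))))) (s≤s (s≤s (s≤s (s≤s ()))))

  omniversal : Σ (LatinSquare (8 ℕ.+ h ℕ.* 8)) Omniversal
  omniversal = Transport.square (Blown↔Fin 8 8 h) L , schemes-omniversal {8} {2} {h} L refl schemes

-- Orders 1, 7 and 8 by evaluation

Table : ℕ → Set
Table n = Vec (Vec (Fin n) n) n

entry : ∀ {n} → Table n → Fin n → Fin n → Fin n
entry t r c = lookup (lookup t r) c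

latin? : ∀ {n} (t : Table n) → Dec ((∀ r c c′ → entry t r c ≡ entry t r c′ → c ≡ c′) × (∀ c r r′ → entry t r c ≡ entry t r′ c → r ≡ r′))
latin? t = (Fin.all? λ r → Fin.all? λ c → Fin.all? λ c′ → (entry t r c Fin.≟ entry t r c′) →-dec (c Fin.≟ c′))
  ×-dec (Fin.all? λ c → Fin.all? λ r → Fin.all? λ r′ → (entry t r c Fin.≟ entry t r′ c) →-dec (r Fin.≟ r′))

tableSquare : ∀ {n} (t : Table n) → does (latin? t) ≡ true → LatinSquare n
tableSquare t e = record
  { sym = entry t
  ; rowInj = λ r {c} {c′} → proj₁ (witness (latin? t) e) r c c′
  ; colInj = λ c {r} {r′} → proj₂ (witness (latin? t) e) c r r′
  }

module _ {n : ℕ} (L : LatinSquare n) (T : List (Cell n)) where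
  open import Data.List.Membership.DecPropositional (Fin._≟_ {n}) using (_∈?_)

  maximal? : Dec (IsPartialTransversal L T × Blocks L T)
  maximal? = allPairs? (λ x y → ¬? (proj₁ x Fin.≟ proj₁ y) ×-dec ¬? (proj₂ x Fin.≟ proj₂ y) ×-dec ¬? (symbolAt L x Fin.≟ symbolAt L y)) T
    ×-dec (Fin.all? λ r → Fin.all? λ c → (r ∈? rowsOf T) ⊎-dec (c ∈? colsOf T) ⊎-dec (sym L r c ∈? symsOf L T))

  maximal! : does maximal? ≡ true → Σ (List (Cell n)) λ T′ → IsMaximalPartialTransversal L T′ × length T′ ≡ length T
  maximal! e = T , blocks⇒maximal {L = L} (proj₁ p) (proj₂ p) , refl
    where
    p : IsPartialTransversal L T × Blocks L T
    p = witness maximal? e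

square1 : LatinSquare 1
square1 = tableSquare
  ((0F ∷ []) ∷ [])
  refl

omniversal1 : Omniversal square1
omniversal1 0 () _
omniversal1 1 _ _ = maximal! square1 ((0F , 0F) ∷ []) refl
omniversal1 (suc (suc _)) _ (s≤s ())

-- The squares of orders 7 and 8 and their transversals come from a computer search.
square7 : LatinSquare 7
square7 = tableSquare
  ((0F ∷ 4F ∷ 1F ∷ 2F ∷ 3F ∷ 5F ∷ 6F ∷ [])
  ∷ (2F ∷ 1F ∷ 5F ∷ 0F ∷ 6F ∷ 4F ∷ 3F ∷ [])
  ∷ (3F ∷ 0F ∷ 2F ∷ 1F ∷ 4F ∷ 6F ∷ 5F ∷ [])
  ∷ (1F ∷ 2F ∷ 0F ∷ 6F ∷ 5F ∷ 3F ∷ 4F ∷ [])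
  ∷ (4F ∷ 3F ∷ 6F ∷ 5F ∷ 2F ∷ 1F ∷ 0F ∷ [])
  ∷ (6F ∷ 5F ∷ 4F ∷ 3F ∷ 1F ∷ 0F ∷ 2F ∷ [])
  ∷ (5F ∷ 6F ∷ 3F ∷ 4F ∷ 0F ∷ 2F ∷ 1F ∷ []) ∷ [])
  refl

omniversal7 : Omniversal square7
omniversal7 0 () _
omniversal7 1 (s≤s ()) _
omniversal7 2 (s≤s (s≤s ())) _
omniversal7 3 (s≤s (s≤s (s≤s ()))) _
omniversal7 4 _ _ = maximal! square7 ((0F , 2F) ∷ (1F , 0F) ∷ (2F , 1F) ∷ (3F , 3F) ∷ []) refl
omniversal7 5 _ _ = maximal! square7 ((1F , 4F) ∷ (2F , 6F) ∷ (3F , 2F) ∷ (4F , 1F) ∷ (6F , 5F) ∷ []) refl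
omniversal7 6 _ _ = maximal! square7 ((1F , 4F) ∷ (2F , 3F) ∷ (3F , 5F) ∷ (4F , 6F) ∷ (5F , 2F) ∷ (6F , 0F) ∷ []) refl
omniversal7 7 _ _ = maximal! square7 ((0F , 1F) ∷ (1F , 2F) ∷ (2F , 0F) ∷ (3F , 3F) ∷ (4F , 5F) ∷ (5F , 6F) ∷ (6F , 4F) ∷ []) refl
omniversal7 (suc (suc (suc (suc (suc (suc (suc (suc _)))))))) _ (s≤s (s≤s (s≤s (s≤s (s≤s (s≤s (s≤s ())))))))

square8 : LatinSquare 8
square8 = tableSquare
  ((3F ∷ 0F ∷ 2F ∷ 1F ∷ 5F ∷ 7F ∷ 6F ∷ 4F ∷ [])
  ∷ (0F ∷ 3F ∷ 1F ∷ 2F ∷ 7F ∷ 5F ∷ 4F ∷ 6F ∷ [])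
  ∷ (2F ∷ 1F ∷ 3F ∷ 0F ∷ 4F ∷ 6F ∷ 7F ∷ 5F ∷ [])
  ∷ (1F ∷ 2F ∷ 0F ∷ 3F ∷ 6F ∷ 4F ∷ 5F ∷ 7F ∷ [])
  ∷ (6F ∷ 4F ∷ 7F ∷ 5F ∷ 0F ∷ 1F ∷ 2F ∷ 3F ∷ [])
  ∷ (7F ∷ 5F ∷ 6F ∷ 4F ∷ 2F ∷ 3F ∷ 0F ∷ 1F ∷ [])
  ∷ (4F ∷ 6F ∷ 5F ∷ 7F ∷ 1F ∷ 2F ∷ 3F ∷ 0F ∷ [])
  ∷ (5F ∷ 7F ∷ 4F ∷ 6F ∷ 3F ∷ 0F ∷ 1F ∷ 2F ∷ []) ∷ [])
  refl

omniversal8 : Omniversal square8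
omniversal8 0 () _
omniversal8 1 (s≤s ()) _
omniversal8 2 (s≤s (s≤s ())) _
omniversal8 3 (s≤s (s≤s (s≤s ()))) _
omniversal8 4 _ _ = maximal! square8 ((0F , 3F) ∷ (1F , 1F) ∷ (2F , 0F) ∷ (3F , 2F) ∷ []) refl
omniversal8 5 _ _ = maximal! square8 ((0F , 0F) ∷ (3F , 4F) ∷ (5F , 1F) ∷ (6F , 3F) ∷ (7F , 6F) ∷ []) refl
omniversal8 6 _ _ = maximal! square8 ((0F , 6F) ∷ (2F , 0F) ∷ (3F , 3F) ∷ (4F , 5F) ∷ (6F , 7F) ∷ (7F , 1F) ∷ []) refl
omniversal8 7 _ _ = maximal! square8 ((0F , 7F) ∷ (1F , 0F) ∷ (2F , 5F) ∷ (3F , 3F) ∷ (4F , 2F) ∷ (5F , 1F) ∷ (6F , 4F) ∷ []) refl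
omniversal8 8 _ _ = maximal! square8 ((0F , 5F) ∷ (1F , 6F) ∷ (2F , 3F) ∷ (3F , 1F) ∷ (4F , 0F) ∷ (5F , 7F) ∷ (6F , 2F) ∷ (7F , 4F) ∷ []) refl
omniversal8 (suc (suc (suc (suc (suc (suc (suc (suc (suc _))))))))) _ (s≤s (s≤s (s≤s (s≤s (s≤s (s≤s (s≤s (s≤s ()))))))))

-- Collecting the orders

data Shape : ℕ → Set where
  zero : Shape 0
  2n+1 : ∀ h → Shape (1 ℕ.+ h ℕ.* 2)
  2n+2 : ∀ h → Shape (2 ℕ.+ h ℕ.* 2)

shape : ∀ q → Shape q
shape zero = zero
shape (suc q) with shape q
... | zero = 2n+1 0
... | 2n+1 h = 2n+2 h
... | 2n+2 h = 2n+1 (suc h)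

multiple-of-four : ∀ q → 1 ≤ q ℕ.* 4 → q ℕ.* 4 ≢ 4 → Σ (LatinSquare (q ℕ.* 4)) Omniversal
multiple-of-four q pos ≢4 with shape q
... | 2n+1 0 = contradiction refl ≢4
... | 2n+1 (suc h) = subst (λ n → Σ (LatinSquare n) Omniversal) (lemma (suc h)) (FourModEight.omniversal h)
  where
  lemma : ∀ h → 4 ℕ.+ h ℕ.* 8 ≡ (1 ℕ.+ h ℕ.* 2) ℕ.* 4
  lemma = solve-∀
... | 2n+2 0 = square8 , omniversal8
... | 2n+2 (suc h) = subst (λ n → Σ (LatinSquare n) Omniversal) (lemma (suc h)) (ZeroModEight.omniversal h)
  where
  lemma : ∀ h → 8 ℕ.+ h ℕ.* 8 ≡ (2 ℕ.+ h ℕ.* 2) ℕ.* 4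
  lemma = solve-∀

existence : ∀ r q → r ℕ.< 4 → 1 ≤ r ℕ.+ q ℕ.* 4 → r ℕ.+ q ℕ.* 4 ≢ 3 → r ℕ.+ q ℕ.* 4 ≢ 4 → r ≢ 2 →
  Σ (LatinSquare (r ℕ.+ q ℕ.* 4)) Omniversal
existence 0 q _ pos _ ≢4 _ = multiple-of-four q pos ≢4
existence 1 0 _ _ _ _ _ = square1 , omniversal1
existence 1 (suc h) _ _ _ _ _ = OneModFour.omniversal h
existence 2 q _ _ _ _ ≢2 = contradiction refl ≢2
existence 3 0 _ _ ≢3 _ _ = contradiction refl ≢3
existence 3 1 _ _ _ _ _ = square7 , omniversal7
existence 3 (suc (suc h)) _ _ _ _ _ = ThreeModFour.omniversal h
existence (suc (suc (suc (suc _)))) _ (s≤s (s≤s (s≤s (s≤s ())))) _ _ _ _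

theorem1p3 : (n : ℕ) → 1 ≤ n →
    (Σ (LatinSquare n) Omniversal) ⇔ (¬ (n ≡ 3) × ¬ (n ≡ 4) × ¬ (n % 4 ≡ 2))
theorem1p3 n 1≤n = mk⇔
  (λ (L , omni) → (λ { refl → ¬omniversal-3 L omni }) , (λ { refl → ¬omniversal-4 L omni }) , λ e → ¬omniversal-2mod4 L e omni)
  λ (≢3 , ≢4 , ≢2) → subst (λ m → Σ (LatinSquare m) Omniversal) (≡.sym n≡)
    (existence (n % 4) (n / 4) (m%n<n n 4) (subst (1 ≤_) n≡ 1≤n) (≢3 ∘ trans n≡) (≢4 ∘ trans n≡) ≢2)
  where
  n≡ : n ≡ n % 4 ℕ.+ n / 4 ℕ.* 4
  n≡ = m≡m%n+[m/n]*n n 4
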